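{- Let $m$ be a natural number, let $C\subseteq\mathbb{F}_2^m$ be a binary linear code, and let $[m]=L\sqcup R$ be any bipartition of the coordinate set. Let $W$ be the conditional decoding matrix of $C$ at the cut $(L,R)$, i.e. the matrix with rows indexed by $\mathbb{F}_2^{L}$, columns indexed by $\mathbb{F}_2^{R}$, and entries $W(x_L,x_R)=\min_{c\in C}|(x_L,x_R)\oplus c|$. Let $s=\dim C-\dim C_L-\dim C_R$, where $C_L=\{c\in C:c_R=0\}$ and $C_R=\{c\in C:c_L=0\}$. Then the min-plus factorization rank of $W$ equals $2^{s}$. Moreover, the tropical rank of $W$ and the Kapranov rank of $W$ also equal $2^{s}$.
   Context: For $x\in\mathbb{F}_2^m$ write $x=(x_L,x_R)$ for its restrictions to $L$ and $R$; $|x|$ is the Hamming weight and $\oplus$ is addition in $\mathbb{F}_2^m$. Min-plus factorization rank (Barvinok rank, factor rank): a matrix $M$ has min-plus factorization rank at most $r$ if there are functions $u_1,\dots,u_r$ on its row index set and $v_1,\dots,v_r$ on its column index set, with values in $\mathbb{R}\cup\{+\infty\}$, such that $M(x,y)=\min_{1\le t\le r}(u_t(x)+v_t(y))$ for all $x,y$; the rank is the least such $r$. Tropical rank: a square matrix $N$ of order $r$ is tropically nonsingular if the minimum $\min_{\sigma\in S_r}\sum_i N(i,\sigma(i))$ is attained by a unique permutation $\sigma$. The tropical rank of $M$ is the largest order of a tropically nonsingular square submatrix of $M$. Kapranov rank (in the sense of Develin, Santos and Sturmfels): let $K$ be the field of generalized power series in one variable $t$ with complex coefficients and real exponents (well-ordered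 support), with valuation $\mathrm{val}$ equal to the least exponent with nonzero coefficient. The Kapranov rank of a real matrix $M$ is the smallest rank of a matrix $\widetilde M$ over $K$ with all entries nonzero and $\mathrm{val}(\widetilde M(x,y))=M(x,y)$ for all $x,y$. -}

module Defs where

open import Data.Bool.Base using (Bool; true; false; _∧_; _xor_)
import Data.Bool.Properties as Bool
open import Data.Fin.Base using (Fin)
open import Data.Fin.Permutation using (Permutation′; _⟨$⟩ʳ_)
open import Data.Fin.Subset using (Subset; inside; outside; ∁; ∣_∣)
open import Data.Integer.Base using (+_)
import Data.List.Base as List
open import Data.List.Base using (List; []; _∷_; _++_; filter)
open import Data.List.Extrema.Nat using (min)
open import Data.List.Membership.Propositional using (_∈_; lose)
open import Data.List.Membership.Propositional.Properties using (∈-map⁺; ∈-++⁺ˡ; ∈-++⁺ʳ)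
import Data.List.Membership.Setoid as SetoidMembership
open import Data.List.Relation.Unary.Any using (here; there; any?; satisfied)
import Data.List.Relation.Unary.Unique.Setoid as SetoidUnique
open import Data.Nat.Base as ℕ using (ℕ; zero; suc; _⊔_)
import Data.Nat.Properties as ℕ
open import Data.Product.Base using (Σ-syntax; ∃; ∃-syntax; _×_; _,_; proj₁; proj₂)
open import Data.Rational.Base as ℚ using (ℚ; 0ℚ; 1ℚ; ½)
import Data.Rational.Properties as ℚ
open import Data.Rational.Solver using (module +-*-Solver)
open import Data.Vec.Base as Vec using (Vec; []; _∷_; zipWith; replicate; count)
import Data.Vec.Functional as Vector
import Data.Vec.Properties as Vec
open import Data.Vec.Relation.Unary.All using (All; []; _∷_)
open import Function.Base using (_on_)
open import Function.Definitions using (Injective)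
open import Induction.WellFounded using (WellFounded)
open import Level using (0ℓ)
open import Relation.Binary.Bundles using (Setoid)
import Relation.Binary.Construct.Add.Supremum.Equality as SupremumEquality
import Relation.Binary.Construct.Add.Supremum.NonStrict as SupremumOrder
open import Relation.Binary.PropositionalEquality
open import Relation.Binary.Structures using (IsEquivalence)
open import Relation.Nullary using (¬_; Dec; yes; no; contradiction)
open import Relation.Nullary.Construct.Add.Supremum using (_⁺; [_]; ⊤⁺)
open import Relation.Nullary.Decidable using (map′; _×-dec_)
open import Relation.Unary using (Pred; Decidable)

IsLeast : Pred ℕ 0ℓ → Pred ℕ 0ℓ
IsLeast P n = P n × (∀ k → P k → n ℕ.≤ k)

IsGreatest : Pred ℕ 0ℓ → Pred ℕ 0ℓ
IsGreatest P n = P n × (∀ k → P k → k ℕ.≤ n)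

F₂^ : ℕ → Set
F₂^ m = Vec Bool m

infixl 6 _⊕_

_⊕_ : ∀ {m} → F₂^ m → F₂^ m → F₂^ m
_⊕_ = zipWith _xor_

𝟘 : ∀ {m} → F₂^ m
𝟘 = replicate _ false

weight : ∀ {m} → F₂^ m → ℕ
weight = count (Bool._≟ true)

-- Over F₂, closure under scalar multiplication amounts to containing 𝟘.
record LinearCode (m : ℕ) : Set₁ where
  field
    Codeword  : Pred (F₂^ m) 0ℓ
    codeword? : Decidable Codeword
    𝟘-closed  : Codeword 𝟘
    ⊕-closed  : ∀ {x y} → Codeword x → Codeword y → Codeword (x ⊕ y)

open LinearCode

allVectors : ∀ m → List (F₂^ m)
allVectors zero    = [] ∷ []
allVectors (suc m) = List.map (false ∷_) (allVectors m) ++ List.map (true ∷_) (allVectors m)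

linearCombination : ∀ {m k} → F₂^ k → Vec (F₂^ m) k → F₂^ m
linearCombination []       []       = 𝟘
linearCombination (a ∷ as) (b ∷ bs) = Vec.map (a ∧_) b ⊕ linearCombination as bs

record IsBasis {m k} (C : LinearCode m) (B : Vec (F₂^ m) k) : Set where
  field
    members     : All (Codeword C) B
    independent : ∀ a → linearCombination a B ≡ 𝟘 → a ≡ 𝟘
    spanning    : ∀ x → Codeword C x → ∃[ a ] linearCombination a B ≡ x

HasDimension : ∀ {m} → LinearCode m → ℕ → Set
HasDimension {m} C k = Σ[ B ∈ Vec (F₂^ m) k ] IsBasis C B

private
  ∈-allVectors : ∀ {m} (x : F₂^ m) → x ∈ allVectors m
  ∈-allVectors []          = here refl
  ∈-allVectors (false ∷ x) = ∈-++⁺ˡ (∈-map⁺ (false ∷_) (∈-allVectors x))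
  ∈-allVectors (true  ∷ x) =
    ∈-++⁺ʳ (List.map (false ∷_) (allVectors _)) (∈-map⁺ (true ∷_) (∈-allVectors x))

  ⊕-identityˡ : ∀ {m} (x : F₂^ m) → 𝟘 ⊕ x ≡ x
  ⊕-identityˡ = Vec.zipWith-identityˡ Bool.xor-identityˡ

  ⊕-identityʳ : ∀ {m} (x : F₂^ m) → x ⊕ 𝟘 ≡ x
  ⊕-identityʳ = Vec.zipWith-identityʳ Bool.xor-identityʳ

  ⊕≡𝟘⇒≡ : ∀ {m} (x y : F₂^ m) → x ⊕ y ≡ 𝟘 → x ≡ y
  ⊕≡𝟘⇒≡ []      []      _  = refl
  ⊕≡𝟘⇒≡ (a ∷ x) (b ∷ y) eq =
    cong₂ _∷_ (bit a b (Vec.∷-injectiveˡ eq)) (⊕≡𝟘⇒≡ x y (Vec.∷-injectiveʳ eq))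
    where
    bit : ∀ a b → a xor b ≡ false → a ≡ b
    bit false false _ = refl
    bit true  true  _ = refl

  scale-false : ∀ {m} (x : F₂^ m) → Vec.map (false ∧_) x ≡ 𝟘
  scale-false x = Vec.map-const x false

  scale-true : ∀ {m} (x : F₂^ m) → Vec.map (true ∧_) x ≡ x
  scale-true = Vec.map-id

  skip : ∀ {m k} x (a : F₂^ k) (B : Vec (F₂^ m) k) →
         linearCombination (false ∷ a) (x ∷ B) ≡ linearCombination a B
  skip x a B = trans (cong (_⊕ _) (scale-false x)) (⊕-identityˡ _)

  take : ∀ {m k} x (a : F₂^ k) (B : Vec (F₂^ m) k) →
         linearCombination (true ∷ a) (x ∷ B) ≡ x ⊕ linearCombination a B
  take x a B = cong (_⊕ _) (scale-true x)

  combination-𝟘 : ∀ {m k} (B : Vec (F₂^ m) k) → linearCombination 𝟘 B ≡ 𝟘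
  combination-𝟘 []      = refl
  combination-𝟘 (x ∷ B) = trans (skip x 𝟘 B) (combination-𝟘 B)

  module _ {m} (C : LinearCode m) where

    InSpan : ∀ {k} → Vec (F₂^ m) k → F₂^ m → Set
    InSpan B x = ∃[ a ] linearCombination a B ≡ x

    inSpan? : ∀ {k} (B : Vec (F₂^ m) k) x → Dec (InSpan B x)
    inSpan? {k} B x = map′ satisfied (λ (a , eq) → lose (∈-allVectors a) eq)
      (any? (λ a → Vec.≡-dec Bool._≟_ (linearCombination a B) x) (allVectors k))

    record IndependentIn {k} (B : Vec (F₂^ m) k) : Set where
      field
        members     : All (Codeword C) B
        independent : ∀ a → linearCombination a B ≡ 𝟘 → a ≡ 𝟘

    open IndependentIn

    adjoin : ∀ {k} {B : Vec (F₂^ m) k} x → Codeword C x → ¬ InSpan B x →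
             IndependentIn B → IndependentIn (x ∷ B)
    adjoin x x∈C x∉B ind .members = x∈C ∷ ind .members
    adjoin {B = B} x x∈C x∉B ind .independent (false ∷ a) eq =
      cong (false ∷_) (ind .independent a (trans (sym (skip x a B)) eq))
    adjoin {B = B} x x∈C x∉B ind .independent (true ∷ a) eq =
      contradiction (a , sym (⊕≡𝟘⇒≡ x _ (trans (sym (take x a B)) eq))) x∉B

    extend : ∀ (xs : List (F₂^ m)) {k} (B : Vec (F₂^ m) k) → IndependentIn B →
             ∃[ l ] Σ[ B′ ∈ Vec (F₂^ m) l ] IndependentIn B′
               × (∀ x → InSpan B x → InSpan B′ x)
               × (∀ x → x ∈ xs → Codeword C x → InSpan B′ x)
    extend []       B ind = _ , B , ind , (λ _ s → s) , λ _ ()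
    extend (y ∷ xs) B ind with codeword? C y | inSpan? B y
    ... | no y∉C | _ =
      let l , B′ , ind′ , mono , new = extend xs B ind
      in  l , B′ , ind′ , mono ,
          λ { _ (here refl) y∈C → contradiction y∈C y∉C ; x (there x∈) → new x x∈ }
    ... | yes _ | yes y∈B =
      let l , B′ , ind′ , mono , new = extend xs B ind
      in  l , B′ , ind′ , mono ,
          λ { _ (here refl) _ → mono y y∈B ; x (there x∈) → new x x∈ }
    ... | yes y∈C | no y∉B =
      let l , B′ , ind′ , mono , new = extend xs (y ∷ B) (adjoin y y∈C y∉B ind)
      in  l , B′ , ind′ ,
          (λ x (a , eq) → mono x (false ∷ a , trans (skip y a B) eq)) ,
          λ { _ (here refl) _ → mono y (true ∷ 𝟘 , trans (take y 𝟘 B)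
                (trans (cong (y ⊕_) (combination-𝟘 B)) (⊕-identityʳ y)))
            ; x (there x∈) → new x x∈ }

dimension : ∀ {m} (C : LinearCode m) → ∃ (HasDimension C)
dimension {m} C =
  let k , B , ind , _ , spans = extend C (allVectors m) [] empty
  in  k , B , record
        { members     = ind .IndependentIn.members
        ; independent = ind .IndependentIn.independent
        ; spanning    = λ x → spans x (∈-allVectors x)
        }
  where
  empty : IndependentIn C []
  empty = record { members = [] ; independent = λ { [] _ → refl } }

dim : ∀ {m} → LinearCode m → ℕ
dim C = proj₁ (dimension C)

-- F₂^S is F₂^ ∣ S ∣, the coordinates in S being listed in increasing order.
restrict : ∀ {m} (S : Subset m) → F₂^ m → F₂^ ∣ S ∣
restrict []            []      = []
restrict (inside  ∷ S) (a ∷ x) = a ∷ restrict S x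
restrict (outside ∷ S) (a ∷ x) = restrict S x

-- The x with restrict S x ≡ xₛ and restrict (∁ S) x ≡ xₜ.
glue : ∀ {m} (S : Subset m) → F₂^ ∣ S ∣ → F₂^ ∣ ∁ S ∣ → F₂^ m
glue []            _        _        = []
glue (inside  ∷ S) (a ∷ xₛ) xₜ       = a ∷ glue S xₛ xₜ
glue (outside ∷ S) xₛ       (a ∷ xₜ) = a ∷ glue S xₛ xₜ

private
  restrict-𝟘 : ∀ {m} (S : Subset m) → restrict S 𝟘 ≡ 𝟘
  restrict-𝟘 []            = refl
  restrict-𝟘 (inside  ∷ S) = cong (false ∷_) (restrict-𝟘 S)
  restrict-𝟘 (outside ∷ S) = restrict-𝟘 S

  restrict-⊕ : ∀ {m} (S : Subset m) x y → restrict S (x ⊕ y) ≡ restrict S x ⊕ restrict S y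
  restrict-⊕ []            []      []      = refl
  restrict-⊕ (inside  ∷ S) (a ∷ x) (b ∷ y) = cong ((a xor b) ∷_) (restrict-⊕ S x y)
  restrict-⊕ (outside ∷ S) (a ∷ x) (b ∷ y) = restrict-⊕ S x y

-- With [m] = L ⊔ R, the code C_L of the codewords with c_R = 0 is
-- vanishingOn R C, and C_R is vanishingOn L C.
vanishingOn : ∀ {m} → Subset m → LinearCode m → LinearCode m
vanishingOn S C = record
  { Codeword  = λ c → Codeword C c × restrict S c ≡ 𝟘
  ; codeword? = λ c → codeword? C c ×-dec Vec.≡-dec Bool._≟_ (restrict S c) 𝟘
  ; 𝟘-closed  = 𝟘-closed C , restrict-𝟘 S
  ; ⊕-closed  = λ {x} {y} (x∈C , x≡𝟘) (y∈C , y≡𝟘) → ⊕-closed C x∈C y∈C ,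
      trans (restrict-⊕ S x y) (trans (cong₂ _⊕_ x≡𝟘 y≡𝟘) (⊕-identityˡ 𝟘))
  }

-- The first argument of min is the default value for an empty list; here it
-- is the entry of the list coming from the codeword 𝟘.
decodingMatrix : ∀ {m} → LinearCode m → (L : Subset m) → F₂^ ∣ L ∣ → F₂^ ∣ ∁ L ∣ → ℕ
decodingMatrix {m} C L xₗ xᵣ =
  min (weight (x ⊕ 𝟘)) (List.map (λ c → weight (x ⊕ c)) (filter (codeword? C) (allVectors m)))
  where x = glue L xₗ xᵣ

IsCauchy : (ℕ → ℚ) → Set
IsCauchy x = ∀ ε → 0ℚ ℚ.< ε →
  ∃[ N ] (∀ i j → N ℕ.≤ i → N ℕ.≤ j → ℚ.∣ x i ℚ.- x j ∣ ℚ.< ε)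

record ℝ : Set where
  constructor mkℝ
  field
    seq    : ℕ → ℚ
    cauchy : IsCauchy seq

open ℝ

Eventually : Pred ℕ 0ℓ → Set
Eventually P = ∃[ N ] (∀ n → N ℕ.≤ n → P n)

infix 4 _≈ᵣ_ _<ᵣ_ _≤ᵣ_

_≈ᵣ_ : ℝ → ℝ → Set
x ≈ᵣ y = ∀ ε → 0ℚ ℚ.< ε → Eventually λ n → ℚ.∣ seq x n ℚ.- seq y n ∣ ℚ.< ε

_<ᵣ_ : ℝ → ℝ → Set
x <ᵣ y = ∃[ ε ] 0ℚ ℚ.< ε × Eventually λ n → seq x n ℚ.+ ε ℚ.< seq y n

_≤ᵣ_ : ℝ → ℝ → Set
x ≤ᵣ y = ∀ ε → 0ℚ ℚ.< ε → Eventually λ n → seq x n ℚ.< seq y n ℚ.+ ε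

private
  open +-*-Solver

  half : ∀ {ε} → 0ℚ ℚ.< ε → 0ℚ ℚ.< ε ℚ.* ½
  half {ε} 0<ε = ℚ.positive⁻¹ (ε ℚ.* ½) {{ℚ.pos*pos⇒pos ε {{ℚ.positive 0<ε}} ½}}

  half+half : ∀ ε → ε ℚ.* ½ ℚ.+ ε ℚ.* ½ ≡ ε
  half+half ε = trans (sym (ℚ.*-distribˡ-+ ε ½ ½)) (ℚ.*-identityʳ ε)

  ∣p-p∣<ε : ∀ p {ε} → 0ℚ ℚ.< ε → ℚ.∣ p ℚ.- p ∣ ℚ.< ε
  ∣p-p∣<ε p 0<ε rewrite ℚ.+-inverseʳ p = 0<ε

  -- A difference r that splits as p + q is small when p and q are.
  split : ∀ {ε r} p q → r ≡ p ℚ.+ q →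
          ℚ.∣ p ∣ ℚ.< ε ℚ.* ½ → ℚ.∣ q ∣ ℚ.< ε ℚ.* ½ → ℚ.∣ r ∣ ℚ.< ε
  split {ε} p q refl p< q< = ℚ.≤-<-trans (ℚ.∣p+q∣≤∣p∣+∣q∣ p q)
    (subst (_ ℚ.<_) (half+half ε) (ℚ.+-mono-< p< q<))

  ∣p-q∣≡∣q-p∣ : ∀ p q → ℚ.∣ p ℚ.- q ∣ ≡ ℚ.∣ q ℚ.- p ∣
  ∣p-q∣≡∣q-p∣ p q = trans
    (cong ℚ.∣_∣ (solve 2 (λ p q → p :- q := :- (q :- p)) refl p q)) (ℚ.∣-p∣≡∣p∣ (q ℚ.- p))

  eventually₂ : ∀ {P Q R : Pred ℕ 0ℓ} → (∀ {n} → P n → Q n → R n) →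
                Eventually P → Eventually Q → Eventually R
  eventually₂ f (M , p) (N , q) = M ⊔ N , λ n ≤n →
    f (p n (ℕ.m⊔n≤o⇒m≤o M N ≤n)) (q n (ℕ.m⊔n≤o⇒n≤o M N ≤n))

  cauchy₂ : ∀ {P Q R : ℕ → ℕ → Set} → (∀ {i j} → P i j → Q i j → R i j) →
            ∃[ N ] (∀ i j → N ℕ.≤ i → N ℕ.≤ j → P i j) →
            ∃[ N ] (∀ i j → N ℕ.≤ i → N ℕ.≤ j → Q i j) →
            ∃[ N ] (∀ i j → N ℕ.≤ i → N ℕ.≤ j → R i j)
  cauchy₂ f (M , p) (N , q) = M ⊔ N , λ i j ≤i ≤j →
    f (p i j (ℕ.m⊔n≤o⇒m≤o M N ≤i) (ℕ.m⊔n≤o⇒m≤o M N ≤j))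
      (q i j (ℕ.m⊔n≤o⇒n≤o M N ≤i) (ℕ.m⊔n≤o⇒n≤o M N ≤j))

≈ᵣ-isEquivalence : IsEquivalence _≈ᵣ_
≈ᵣ-isEquivalence = record
  { refl  = λ {x} ε 0<ε → 0 , λ n _ → ∣p-p∣<ε (seq x n) 0<ε
  ; sym   = λ {x} {y} x≈y ε 0<ε → let N , h = x≈y ε 0<ε in
      N , λ n N≤n → subst (ℚ._< ε) (∣p-q∣≡∣q-p∣ (seq x n) (seq y n)) (h n N≤n)
  ; trans = λ {x} {y} {z} x≈y y≈z ε 0<ε → eventually₂
      (λ {n} → split (seq x n ℚ.- seq y n) (seq y n ℚ.- seq z n)
        (solve 3 (λ p q r → p :- r := (p :- q) :+ (q :- r)) refl (seq x n) (seq y n) (seq z n)))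
      (x≈y (ε ℚ.* ½) (half 0<ε)) (y≈z (ε ℚ.* ½) (half 0<ε))
  }

ℝ-setoid : Setoid 0ℓ 0ℓ
ℝ-setoid = record { isEquivalence = ≈ᵣ-isEquivalence }

fromℚ : ℚ → ℝ
fromℚ q = mkℝ (λ _ → q) λ ε 0<ε → 0 , λ _ _ _ _ → ∣p-p∣<ε q 0<ε

fromℕ : ℕ → ℝ
fromℕ n = fromℚ (+ n ℚ./ 1)

0ᵣ : ℝ
0ᵣ = fromℚ 0ℚ

infixl 6 _+ᵣ_ _-ᵣ_
infixl 7 _*ᵣ_
infix  8 -ᵣ_

_+ᵣ_ : ℝ → ℝ → ℝ
seq    (x +ᵣ y) n     = seq x n ℚ.+ seq y n
cauchy (x +ᵣ y) ε 0<ε = cauchy₂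
  (λ {i} {j} → split (seq x i ℚ.- seq x j) (seq y i ℚ.- seq y j)
    (solve 4 (λ a b c d → (a :+ c) :- (b :+ d) := (a :- b) :+ (c :- d)) refl
      (seq x i) (seq x j) (seq y i) (seq y j)))
  (cauchy x (ε ℚ.* ½) (half 0<ε)) (cauchy y (ε ℚ.* ½) (half 0<ε))

-ᵣ_ : ℝ → ℝ
seq    (-ᵣ x) n     = ℚ.- seq x n
cauchy (-ᵣ x) ε 0<ε = let N , h = cauchy x ε 0<ε in
  N , λ i j N≤i N≤j → subst (ℚ._< ε)
    (trans (∣p-q∣≡∣q-p∣ (seq x i) (seq x j))
      (cong ℚ.∣_∣ (solve 2 (λ a b → b :- a := (:- a) :- (:- b)) refl (seq x i) (seq x j))))
    (h i j N≤i N≤j)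

_-ᵣ_ : ℝ → ℝ → ℝ
x -ᵣ y = x +ᵣ (-ᵣ y)

private
  bounded : ∀ x → ∃[ B ] 0ℚ ℚ.< B × Eventually λ n → ℚ.∣ seq x n ∣ ℚ.< B
  bounded x =
    let N , h = cauchy x 1ℚ (ℚ.positive⁻¹ 1ℚ)
        c     = seq x N
    in  1ℚ ℚ.+ ℚ.∣ c ∣ , ℚ.+-mono-<-≤ (ℚ.positive⁻¹ 1ℚ) (ℚ.0≤∣p∣ c) , N , λ n N≤n →
          ℚ.≤-<-trans
            (subst (ℚ._≤ ℚ.∣ seq x n ℚ.- c ∣ ℚ.+ ℚ.∣ c ∣)
              (cong ℚ.∣_∣ (solve 2 (λ a c → (a :- c) :+ c := a) refl (seq x n) c))
              (ℚ.∣p+q∣≤∣p∣+∣q∣ (seq x n ℚ.- c) c))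
            (ℚ.+-monoˡ-< ℚ.∣ c ∣ (h n N N≤n ℕ.≤-refl))

  shrink : ∀ {B ε} → 0ℚ ℚ.< B → 0ℚ ℚ.< ε →
           ∃[ δ ] 0ℚ ℚ.< δ ×
             (∀ p q → ℚ.∣ p ∣ ℚ.< B → ℚ.∣ q ∣ ℚ.< δ → ℚ.∣ p ℚ.* q ∣ ℚ.< ε)
  shrink {B} {ε} 0<B 0<ε = δ , 0<δ , λ p q p<B q<δ → begin-strict
      ℚ.∣ p ℚ.* q ∣         ≡⟨ ℚ.∣p*q∣≡∣p∣*∣q∣ p q ⟩
      ℚ.∣ p ∣ ℚ.* ℚ.∣ q ∣   ≤⟨ ℚ.*-monoʳ-≤-nonNeg ℚ.∣ q ∣ {{ℚ.∣-∣-nonNeg q}} (ℚ.<⇒≤ p<B) ⟩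
      B ℚ.* ℚ.∣ q ∣         <⟨ ℚ.*-monoʳ-<-pos B q<δ ⟩
      B ℚ.* δ               ≡⟨ solve 3 (λ b i e → b :* (i :* e) := (b :* i) :* e) refl B (ℚ.1/ B) ε ⟩
      (B ℚ.* ℚ.1/ B) ℚ.* ε  ≡⟨ cong (ℚ._* ε) (ℚ.*-inverseʳ B) ⟩
      1ℚ ℚ.* ε              ≡⟨ ℚ.*-identityˡ ε ⟩
      ε                     ∎
    where
    open ℚ.≤-Reasoning
    instance
      B-positive = ℚ.positive 0<B
      B-nonZero  = ℚ.pos⇒nonZero B
      ε-positive = ℚ.positive 0<ε
      i-positive = ℚ.1/pos⇒pos B
    δ   = ℚ.1/ B ℚ.* ε
    0<δ = ℚ.positive⁻¹ δ {{ℚ.pos*pos⇒pos (ℚ.1/ B) ε}}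

_*ᵣ_ : ℝ → ℝ → ℝ
seq    (x *ᵣ y) n     = seq x n ℚ.* seq y n
cauchy (x *ᵣ y) ε 0<ε =
  let A , 0<A , M , x<A = bounded x
      B , 0<B , N , y<B = bounded y
      δ , 0<δ , small-y = shrink 0<A (half 0<ε)
      η , 0<η , small-x = shrink 0<B (half 0<ε)
      I , hx = cauchy x η 0<η
      J , hy = cauchy y δ 0<δ
      K = (M ⊔ N) ⊔ (I ⊔ J)
      M≤ = λ {n} (K≤n : K ℕ.≤ n) → ℕ.m⊔n≤o⇒m≤o M N (ℕ.m⊔n≤o⇒m≤o (M ⊔ N) (I ⊔ J) K≤n)
      N≤ = λ {n} (K≤n : K ℕ.≤ n) → ℕ.m⊔n≤o⇒n≤o M N (ℕ.m⊔n≤o⇒m≤o (M ⊔ N) (I ⊔ J) K≤n)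
      I≤ = λ {n} (K≤n : K ℕ.≤ n) → ℕ.m⊔n≤o⇒m≤o I J (ℕ.m⊔n≤o⇒n≤o (M ⊔ N) (I ⊔ J) K≤n)
      J≤ = λ {n} (K≤n : K ℕ.≤ n) → ℕ.m⊔n≤o⇒n≤o I J (ℕ.m⊔n≤o⇒n≤o (M ⊔ N) (I ⊔ J) K≤n)
  in  K , λ i j K≤i K≤j → split
        (seq x i ℚ.* (seq y i ℚ.- seq y j)) (seq y j ℚ.* (seq x i ℚ.- seq x j))
        (solve 4 (λ a b c d → a :* c :- b :* d := a :* (c :- d) :+ d :* (a :- b)) refl
          (seq x i) (seq x j) (seq y i) (seq y j))
        (small-y _ _ (x<A i (M≤ K≤i)) (hy i j (J≤ K≤i) (J≤ K≤j)))
        (small-x _ _ (y<B j (N≤ K≤j)) (hx i j (I≤ K≤i) (I≤ K≤j)))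

sumᵣ : ∀ {n} → (Fin n → ℝ) → ℝ
sumᵣ = Vector.foldr _+ᵣ_ 0ᵣ

record ℂ : Set where
  constructor _+i_
  field
    re im : ℝ

open ℂ

infix 4 _≈ᶜ_ _≉ᶜ_

_≈ᶜ_ : ℂ → ℂ → Set
z ≈ᶜ w = re z ≈ᵣ re w × im z ≈ᵣ im w

_≉ᶜ_ : ℂ → ℂ → Set
z ≉ᶜ w = ¬ (z ≈ᶜ w)

0ᶜ : ℂ
0ᶜ = 0ᵣ +i 0ᵣ

infixl 6 _+ᶜ_
infixl 7 _*ᶜ_

_+ᶜ_ : ℂ → ℂ → ℂ
(a +i b) +ᶜ (c +i d) = (a +ᵣ c) +i (b +ᵣ d)

_*ᶜ_ : ℂ → ℂ → ℂ
(a +i b) *ᶜ (c +i d) = (a *ᵣ c -ᵣ b *ᵣ d) +i (a *ᵣ d +ᵣ b *ᵣ c)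

sumᶜ : ∀ {n} → (Fin n → ℂ) → ℂ
sumᶜ = Vector.foldr _+ᶜ_ 0ᶜ

-- Generalized power series Σ_γ coeff γ · t^γ with complex coefficients and
-- real exponents. Equality of reals is undecidable, so that even the series t
-- is a function ℝ → ℂ only under excluded middle; K is meant to be used there.

InSupport : (ℝ → ℂ) → Pred ℝ 0ℓ
InSupport f γ = f γ ≉ᶜ 0ᶜ

-- As _<ᵣ_ is a linear order, well-ordered means well-founded.
record K : Set where
  field
    coeff       : ℝ → ℂ
    coeff-cong  : ∀ {γ δ} → γ ≈ᵣ δ → coeff γ ≈ᶜ coeff δ
    wellOrdered : WellFounded {A = ∃ (InSupport coeff)} (_<ᵣ_ on proj₁)

open K

IsZero : K → Set
IsZero f = ∀ γ → coeff f γ ≈ᶜ 0ᶜ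

HasValuation : K → ℝ → Set
HasValuation f γ = InSupport (coeff f) γ × (∀ δ → InSupport (coeff f) δ → γ ≤ᵣ δ)

-- h = f · g: the coefficient of h at γ is Σ_α f(α) g(γ - α), a sum over any
-- finite set of exponents α containing all those with a nonzero contribution.
-- Well-ordered supports guarantee that such a finite set exists, but only
-- non-constructively, so multiplication is given by its graph.
IsProduct : K → K → K → Set
IsProduct f g h = ∀ γ → Σ[ αs ∈ List ℝ ]
    Unique αs
  × (∀ α → InSupport (coeff f) α → InSupport (coeff g) (γ -ᵣ α) → α ∈ᵣ αs)
  × coeff h γ ≈ᶜ List.foldr _+ᶜ_ 0ᶜ (List.map (λ α → coeff f α *ᶜ coeff g (γ -ᵣ α)) αs)
  where
  open SetoidUnique ℝ-setoid using (Unique)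
  open SetoidMembership ℝ-setoid using () renaming (_∈_ to _∈ᵣ_)

-- Here p x j is the product c j · A x j, so that the hypotheses express
-- Σ_j c j · A x j = 0 for all x.
IsIndependent : ∀ {X : Set} {k} → (X → Fin k → K) → Set
IsIndependent {X} {k} A = ∀ (c : Fin k → K) (p : X → Fin k → K) →
  (∀ x j → IsProduct (c j) (A x j) (p x j)) →
  (∀ x γ → sumᶜ (λ j → coeff (p x j) γ) ≈ᶜ 0ᶜ) →
  ∀ j → IsZero (c j)

-- The rank over K, as the largest number of linearly independent columns.
IsRank : ∀ {X Y : Set} → (X → Y → K) → ℕ → Set
IsRank {X} {Y} A = IsGreatest λ k →
  Σ[ col ∈ (Fin k → Y) ] IsIndependent (λ x j → A x (col j))

infixl 6 _+⁺_

_+⁺_ : ℝ ⁺ → ℝ ⁺ → ℝ ⁺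
[ a ] +⁺ [ b ] = [ a +ᵣ b ]
[ _ ] +⁺ ⊤⁺    = ⊤⁺
⊤⁺    +⁺ _     = ⊤⁺

open SupremumEquality _≈ᵣ_ using (_≈⁺_)
open SupremumOrder _≤ᵣ_ using (_≤⁺_)

IsMinimum : ∀ {n} → (Fin n → ℝ ⁺) → ℝ ⁺ → Set
IsMinimum a v = (∀ t → v ≤⁺ a t) × (∃[ t ] v ≈⁺ a t)

module _ {X Y : Set} (M : X → Y → ℝ) where

  HasMinPlusFactorization : ℕ → Set
  HasMinPlusFactorization r =
    Σ[ u ∈ (Fin r → X → ℝ ⁺) ] Σ[ v ∈ (Fin r → Y → ℝ ⁺) ]
      (∀ x y → IsMinimum (λ t → u t x +⁺ v t y) [ M x y ])

  IsMinPlusRank : ℕ → Set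
  IsMinPlusRank = IsLeast HasMinPlusFactorization

  IsLift : (X → Y → K) → Set
  IsLift A = ∀ x y → ¬ IsZero (A x y) × HasValuation (A x y) (M x y)

  IsKapranovRank : ℕ → Set
  IsKapranovRank = IsLeast λ r → Σ[ A ∈ (X → Y → K) ] IsLift A × IsRank A r

module _ {r} (N : Fin r → Fin r → ℝ) where

  IsOptimal : Permutation′ r → Set
  IsOptimal σ = ∀ τ → sumᵣ (λ i → N i (σ ⟨$⟩ʳ i)) ≤ᵣ sumᵣ (λ i → N i (τ ⟨$⟩ʳ i))

  TropicallyNonsingular : Set
  TropicallyNonsingular = Σ[ σ ∈ Permutation′ r ]
    IsOptimal σ × (∀ τ → IsOptimal τ → ∀ i → τ ⟨$⟩ʳ i ≡ σ ⟨$⟩ʳ i)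

IsTropicalRank : ∀ {X Y : Set} → (X → Y → ℝ) → ℕ → Set
IsTropicalRank {X} {Y} M = IsGreatest λ r →
  Σ[ row ∈ (Fin r → X) ] Σ[ col ∈ (Fin r → Y) ]
    Injective _≡_ _≡_ row × Injective _≡_ _≡_ col
      × TropicallyNonsingular (λ i j → M (row i) (col j))

{-# OPTIONS --safe #-}

-- Let c_t run over representatives of C / (C_L ⊕ C_R); there are 2^s of them. A
-- codeword is c_t ⊕ a ⊕ b with a in C_L and b in C_R, and then the left and right
-- halves of the distance to it can be minimised separately: W(x, y) is the
-- minimum over t of d(x, (c_t)_L + C_L) + d(y, (c_t)_R + C_R). On the rows (c_t)_L
-- and columns (c_t)_R, W vanishes on the diagonal and is positive elsewhere.
--
-- The factorization bounds the tropical rank (exchange two entries of an optimal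
-- permutation served by the same term) and the Kapranov rank: the lift
-- Σ_t z^(u_t(x) + v_t(y)) has no cancellation, and any 2^s + 1 of its columns are
-- related by polynomials. The submatrix is tropically nonsingular, no term of a
-- factorization attains two of its diagonal entries, and the columns of every
-- lift are independent there: look at the least exponent among the coefficients
-- of a relation.
module Submission where

open import Defs
open import Algebra.Bundles using (AbelianGroup; CommutativeRing; Monoid)
import Algebra.Properties.CommutativeMonoid.Sum as CommutativeMonoidSum
import Algebra.Properties.CommutativeSemigroup as CommutativeSemigroupProperties
import Algebra.Properties.Group as GroupProperties
import Algebra.Properties.Monoid.Sum as MonoidSum
import Algebra.Properties.Semiring.Sum as SemiringSum
open import Axiom.ExcludedMiddle using (ExcludedMiddle)
open import Data.Bool.Base using (true; false; if_then_else_; _∧_; _xor_)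
import Data.Bool.Properties as Bool
open import Data.Empty using (⊥)
open import Data.Fin.Base using (Fin; zero; suc; toℕ; fromℕ<; combine; remQuot; punchIn)
import Data.Fin.Permutation as Permutation
open Permutation using (Permutation′; _⟨$⟩ʳ_; _⟨$⟩ˡ_; _∘ₚ_)
import Data.Fin.Permutation.Components as Components
import Data.Fin.Properties as Fin
open import Data.Fin.Subset using (Subset; inside; outside; ∁; ∣_∣)
import Data.Integer.Base as ℤ
import Data.Integer.Properties as ℤ
open import Data.List.Base as List using (List; []; _∷_; applyUpTo)
import Data.List.Extrema.Nat as Extrema
open import Data.List.Membership.Propositional using (_∈_)
import Data.List.Membership.Propositional.Properties as ∈
import Data.List.Membership.Setoid as SetoidMembership
open import Data.List.Relation.Unary.All as ListAll using ([]; _∷_)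
open import Data.List.Relation.Unary.AllPairs as AllPairs using (_∷_)
open import Data.List.Relation.Unary.Any using (here; there)
import Data.List.Relation.Unary.Any.Properties as Any
import Data.List.Relation.Unary.Unique.Setoid as SetoidUnique
import Data.List.Relation.Unary.Unique.Setoid.Properties as UniqueProperties
open import Data.Nat.Base as ℕ using (ℕ; zero; suc; _+_; _∸_; _^_; _≤_; _⊔_; z≤n; s≤s)
open import Data.Nat.Induction using (<-wellFounded)
import Data.Nat.Properties as ℕ
open import Data.Product.Base using (Σ-syntax; ∃; ∃-syntax; ∃₂; _×_; _,_; proj₁; proj₂)
open import Data.Rational.Base as ℚ using (ℚ; 0ℚ; 1ℚ; ½)
import Data.Rational.Properties as ℚ
open import Data.Rational.Solver using (module +-*-Solver)
import Data.Rational.Unnormalised.Base as ℚᵘ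
import Data.Rational.Unnormalised.Properties as ℚᵘ
open import Data.Sum.Base using (_⊎_; inj₁; inj₂)
open import Data.Vec.Base as Vec using (Vec; []; _∷_; _++_)
import Data.Vec.Functional as Vector
import Data.Vec.Functional.Properties as Vector
import Data.Vec.Properties as Vec
open import Data.Vec.Relation.Unary.All as All using (All; []; _∷_)
import Data.Vec.Relation.Unary.All.Properties as All
open import Function.Base using (_∘_; _on_; id; case_of_)
open import Function.Bundles using (Inverse)
open import Function.Definitions using (Injective)
open import Induction.WellFounded using (Acc; acc; WellFounded)
open import Level using (0ℓ)
open import Relation.Binary.Bundles using (Poset; Setoid)
open import Relation.Binary.Construct.Add.Supremum.Equality _≈ᵣ_ using (_≈⁺_; [_])
open import Relation.Binary.Construct.Add.Supremum.NonStrict _≤ᵣ_ using (_≤⁺_; [_])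
open import Relation.Binary.PropositionalEquality
open import Relation.Binary.PropositionalEquality.Algebra using (isMagma)
import Relation.Binary.Reasoning.PartialOrder as PosetReasoning
open import Relation.Binary.Structures using (IsEquivalence)
open import Relation.Nullary using (¬_; Dec; yes; no; does; contradiction)
open import Relation.Nullary.Construct.Add.Supremum using (_⁺; [_])
open import Relation.Nullary.Decidable using (¬?; dec-true; dec-false; decidable-stable; map′)

-- The linear algebra over F₂ ends in two certificates of the same size 2^s for a matrix of natural
-- numbers, `Factorization` and `FoolingSet`; all three ranks are read off from these alone. The
-- obstacle is the Kapranov upper bound. The lift is the product of the matrices (z^u_t(x)) and
-- (z^v_t(y)) of inner size r = 2^s, so a relation among k > r columns comes from a kernel vector of
-- an r × k block of the second factor. Elimination over `K` would require reciprocals of series,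
-- while even multiplication is only a relation there. Instead the kernel vector is sought among
-- polynomials of bounded degree with rational coefficients: comparing coefficients gives a
-- homogeneous linear system over ℚ, and for a large enough degree bound the unknowns outnumber the
-- equations because k > r. Excluded middle enters with `K`: it decides whether a real exponent is a
-- natural number, whether a smaller exponent remains in a support, and whether a coefficient
-- vanishes.

open +-*-Solver using (solve; con; :-_; _:+_; _:*_; _:-_; _:=_)
open CommutativeMonoidSum ℕ.+-0-commutativeMonoid using (sum-permute)
  renaming (sum to sumℕ; ∑-distrib-+ to ∑ℕ-distrib-+)
open CommutativeMonoidSum ℚ.+-0-commutativeMonoid using (∑-comm; sum-remove; sum-cong-≗)
  renaming (sum to sumℚ; ∑-distrib-+ to ∑ℚ-distrib-+)
open SemiringSum (CommutativeRing.semiring ℚ.+-*-commutativeRing) using (*-distribˡ-sum)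
open SetoidMembership ℝ-setoid using () renaming (_∈_ to _∈ᵣ_)
open SetoidUnique ℝ-setoid using () renaming (Unique to Uniqueᵣ)
open LinearCode
open ℝ
open ℂ
open K

-- Finite sums

module FiniteSum {c ℓ} (M : Monoid c ℓ) where
  open Monoid M renaming (refl to ≈-refl; trans to ≈-trans)
    using (Carrier; _≈_; _∙_; ε; ∙-cong; ∙-congˡ; identityˡ; identityʳ)
  open MonoidSum M public using (sum; sum-cong-≋)

  sum-zero : ∀ {n} (f : Fin n → Carrier) → (∀ i → f i ≈ ε) → sum f ≈ ε
  sum-zero {n} f f≈0 = ≈-trans (MonoidSum.sum-cong-≋ M f≈0) (MonoidSum.sum-replicate-zero M n)

  sum-single : ∀ {n} (f : Fin n → Carrier) j → (∀ i → i ≢ j → f i ≈ ε) → sum f ≈ f j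
  sum-single f zero    f≈0 = ≈-trans (∙-congˡ (sum-zero (f ∘ suc) (λ i → f≈0 (suc i) λ ()))) (identityʳ (f zero))
  sum-single f (suc j) f≈0 = ≈-trans (∙-cong (f≈0 zero λ ())
    (sum-single (f ∘ suc) j (λ i i≢j → f≈0 (suc i) (i≢j ∘ Fin.suc-injective)))) (identityˡ (f (suc j)))

  -- Built from `foldr` and `map` so that at `+ᶜ-monoid` it is definitionally the sum in
  -- `IsProduct`.
  listSum : {A : Set} → (A → Carrier) → List A → Carrier
  listSum f xs = List.foldr _∙_ ε (List.map f xs)

  listSum-zero : ∀ {A : Set} (f : A → Carrier) {xs} → ListAll.All (λ x → f x ≈ ε) xs → listSum f xs ≈ ε
  listSum-zero f []            = ≈-refl
  listSum-zero f (fx≈0 ∷ f≈0) = ≈-trans (∙-cong fx≈0 (listSum-zero f f≈0)) (identityˡ ε)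

  module _ (S : Setoid 0ℓ 0ℓ) where
    open Setoid S using () renaming (Carrier to A; _≈_ to _∼_; sym to ∼-sym; trans to ∼-trans)
    open SetoidMembership S using () renaming (_∈_ to _∈ₛ_)
    open SetoidUnique S using (Unique)

    -- Entries are distinct only up to `_∼_`, so `x` may occur as another representative; hence the
    -- congruence hypothesis at `x`.
    listSum-single : ∀ (f : A → Carrier) {xs} x → (∀ {y} → x ∼ y → f y ≈ f x) → (∀ {y} → ¬ x ∼ y → f y ≈ ε) →
      Unique xs → x ∈ₛ xs → listSum f xs ≈ f x
    listSum-single f x f-cong f≈0 (y∉ ∷ _) (here x∼y) = ≈-trans
      (∙-cong (f-cong x∼y) (listSum-zero f (ListAll.map (λ y≁z → f≈0 λ x∼z → y≁z (∼-trans (∼-sym x∼y) x∼z)) y∉)))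
      (identityʳ (f x))
    listSum-single f x f-cong f≈0 (y∉ ∷ unique) (there x∈) = ≈-trans
      (∙-cong (f≈0 (distinct y∉ x∈)) (listSum-single f x f-cong f≈0 unique x∈)) (identityˡ (f x))
      where
      distinct : ∀ {y xs} → ListAll.All (λ z → ¬ y ∼ z) xs → x ∈ₛ xs → ¬ x ∼ y
      distinct (y≁z ∷ _) (here x∼z) x∼y = y≁z (∼-trans (∼-sym x∼y) x∼z)
      distinct (_ ∷ y∉)  (there x∈) x∼y = distinct y∉ x∈ x∼y

module _ {c ℓ} (M : Monoid c ℓ) {c′ ℓ′} (N : Monoid c′ ℓ′) where
  private
    module M = Monoid M
    module N = Monoid N

  sum-homo : (h : M.Carrier → N.Carrier) → h M.ε N.≈ N.ε → (∀ x y → h (x M.∙ y) N.≈ h x N.∙ h y) →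
    ∀ {n} (f : Fin n → M.Carrier) → h (MonoidSum.sum M f) N.≈ MonoidSum.sum N (h ∘ f)
  sum-homo h h-ε h-∙ {zero}  f = h-ε
  sum-homo h h-ε h-∙ {suc n} f = N.trans (h-∙ (f zero) _) (N.∙-congˡ (sum-homo h h-ε h-∙ (f ∘ suc)))

module ℕSum = FiniteSum ℕ.+-0-monoid
module ℚSum = FiniteSum ℚ.+-0-monoid

sum-mono : ∀ {n} {f g : Fin n → ℕ} → (∀ i → f i ≤ g i) → sumℕ f ≤ sumℕ g
sum-mono {zero}  f≤g = z≤n
sum-mono {suc n} f≤g = ℕ.+-mono-≤ (f≤g zero) (sum-mono (f≤g ∘ suc))

sum≡0⇒≡0 : ∀ {n} (f : Fin n → ℕ) → sumℕ f ≡ 0 → ∀ i → f i ≡ 0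
sum≡0⇒≡0 f eq zero    = ℕ.m+n≡0⇒m≡0 (f zero) eq
sum≡0⇒≡0 f eq (suc i) = sum≡0⇒≡0 (f ∘ suc) (ℕ.m+n≡0⇒n≡0 (f zero) eq) i

-- Linear algebra over F₂

-- Inversion is the identity in characteristic 2, so the general group lemmas about x ∙ y⁻¹ become
-- lemmas about `x ⊕ y`.
⊕-abelianGroup : ℕ → AbelianGroup 0ℓ 0ℓ
⊕-abelianGroup m = record
  { Carrier = F₂^ m ; _≈_ = _≡_ ; _∙_ = _⊕_ ; ε = 𝟘 ; _⁻¹ = id
  ; isAbelianGroup = record
    { isGroup = record
      { isMonoid = record
        { isSemigroup = record
          { isMagma = isMagma _⊕_
          ; assoc   = Vec.zipWith-assoc Bool.xor-assoc }
        ; identity = Vec.zipWith-identityˡ Bool.xor-identityˡ , Vec.zipWith-identityʳ Bool.xor-identityʳ }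
      ; inverse = (λ x → self x) , self
      ; ⁻¹-cong = id }
    ; comm = Vec.zipWith-comm Bool.xor-comm } }
  where
  self : ∀ {m} (x : F₂^ m) → x ⊕ x ≡ 𝟘
  self []      = refl
  self (a ∷ x) = cong₂ _∷_ (Bool.xor-same a) (self x)

module _ {m : ℕ} where
  open AbelianGroup (⊕-abelianGroup m) public using ()
    renaming (assoc to ⊕-assoc; identityˡ to ⊕-identityˡ; identityʳ to ⊕-identityʳ; inverseʳ to ⊕-self)
  open GroupProperties (AbelianGroup.group (⊕-abelianGroup m)) public using ()
    renaming (x∙y⁻¹≈ε⇒x≈y to x⊕y≡𝟘⇒x≡y; \\-leftDividesʳ to x⊕[x⊕y]≡y)
  open CommutativeSemigroupProperties (AbelianGroup.commutativeSemigroup (⊕-abelianGroup m)) public using ()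
    renaming (interchange to ⊕-interchange; x∙yz≈y∙xz to x⊕yz≡y⊕xz)

scale-⊕ : ∀ {m} a b (x : F₂^ m) → Vec.map ((a xor b) ∧_) x ≡ Vec.map (a ∧_) x ⊕ Vec.map (b ∧_) x
scale-⊕ a b []      = refl
scale-⊕ a b (c ∷ x) = cong₂ _∷_ (Bool.∧-distribʳ-xor c a b) (scale-⊕ a b x)

module _ {m : ℕ} where

  linearCombination-false : ∀ {k} (a : F₂^ k) x (B : Vec (F₂^ m) k) →
    linearCombination (false ∷ a) (x ∷ B) ≡ linearCombination a B
  linearCombination-false a x B = trans (cong (_⊕ _) (Vec.map-const x false)) (⊕-identityˡ _)

  linearCombination-true : ∀ {k} (a : F₂^ k) x (B : Vec (F₂^ m) k) →
    linearCombination (true ∷ a) (x ∷ B) ≡ x ⊕ linearCombination a B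
  linearCombination-true a x B = cong (_⊕ _) (Vec.map-id x)

  linearCombination-𝟘 : ∀ {k} (B : Vec (F₂^ m) k) → linearCombination 𝟘 B ≡ 𝟘
  linearCombination-𝟘 []      = refl
  linearCombination-𝟘 (x ∷ B) = trans (linearCombination-false 𝟘 x B) (linearCombination-𝟘 B)

  linearCombination-⊕ : ∀ {k} (a b : F₂^ k) (B : Vec (F₂^ m) k) →
    linearCombination (a ⊕ b) B ≡ linearCombination a B ⊕ linearCombination b B
  linearCombination-⊕ []       []       []      = sym (⊕-identityˡ 𝟘)
  linearCombination-⊕ (a ∷ as) (b ∷ bs) (x ∷ B) =
    trans (cong₂ _⊕_ (scale-⊕ a b x) (linearCombination-⊕ as bs B)) (⊕-interchange _ _ _ _)

  linearCombination-++ : ∀ {k l} (a : F₂^ k) (b : F₂^ l) (A : Vec (F₂^ m) k) (B : Vec (F₂^ m) l) →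
    linearCombination (a ++ b) (A ++ B) ≡ linearCombination a A ⊕ linearCombination b B
  linearCombination-++ []      b []      B = sym (⊕-identityˡ _)
  linearCombination-++ (c ∷ a) b (x ∷ A) B =
    trans (cong (_ ⊕_) (linearCombination-++ a b A B)) (sym (⊕-assoc _ _ _))

  Independent : ∀ {k} → Vec (F₂^ m) k → Set
  Independent B = ∀ a → linearCombination a B ≡ 𝟘 → a ≡ 𝟘

  Spans : ∀ {k} → LinearCode m → Vec (F₂^ m) k → Set
  Spans C B = ∀ x → Codeword C x → ∃[ a ] linearCombination a B ≡ x

  independent⇒injective : ∀ {k} {B : Vec (F₂^ m) k} → Independent B →
    ∀ {a b} → linearCombination a B ≡ linearCombination b B → a ≡ b
  independent⇒injective {B = B} ind {a} {b} eq = x⊕y≡𝟘⇒x≡y a b (ind (a ⊕ b)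
    (trans (linearCombination-⊕ a b B) (trans (cong (_⊕ _) eq) (⊕-self _))))

  linearCombination-closed : ∀ (C : LinearCode m) {k} {B : Vec (F₂^ m) k} →
    All (Codeword C) B → ∀ a → Codeword C (linearCombination a B)
  linearCombination-closed C []        []          = 𝟘-closed C
  linearCombination-closed C {B = x ∷ B} (_ ∷ mem)   (false ∷ a) =
    subst (Codeword C) (sym (linearCombination-false a x B)) (linearCombination-closed C mem a)
  linearCombination-closed C {B = x ∷ B} (x∈ ∷ mem) (true ∷ a) =
    subst (Codeword C) (sym (linearCombination-true a x B)) (⊕-closed C x∈ (linearCombination-closed C mem a))

private
  module Bit = Inverse Fin.2↔Bool

-- Not the rank of a matrix but the position of a bit vector in an enumeration of `F₂^ k`. It serves
-- to count vectors and to label coset representatives.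
rank : ∀ {k} → F₂^ k → Fin (2 ^ k)
rank []      = zero
rank (a ∷ x) = combine (Bit.from a) (rank x)

unrank : ∀ {k} → Fin (2 ^ k) → F₂^ k
unrank {zero}  _ = []
unrank {suc k} i = let b , j = remQuot {2} (2 ^ k) i in Bit.to b ∷ unrank j

unrank-rank : ∀ {k} (x : F₂^ k) → unrank (rank x) ≡ x
unrank-rank []      = refl
unrank-rank (a ∷ x) = trans
  (cong (λ (b , j) → Bit.to b ∷ unrank j) (Fin.remQuot-combine (Bit.from a) (rank x)))
  (cong₂ _∷_ (Bit.strictlyInverseˡ a) (unrank-rank x))

rank-unrank : ∀ {k} (i : Fin (2 ^ k)) → rank {k} (unrank i) ≡ i
rank-unrank {zero}  zero = refl
rank-unrank {suc k} i    = let b , j = remQuot {2} (2 ^ k) i in trans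
  (cong₂ combine (Bit.strictlyInverseʳ b) (rank-unrank {k} j)) (Fin.combine-remQuot {2} (2 ^ k) i)

unrank-injective : ∀ {k} → Injective _≡_ _≡_ (unrank {k})
unrank-injective {k} {i} {j} eq = trans (sym (rank-unrank {k} i)) (trans (cong rank eq) (rank-unrank {k} j))

rank-injective : ∀ {k} → Injective _≡_ _≡_ (rank {k})
rank-injective {k} {x} {y} eq = trans (sym (unrank-rank x)) (trans (cong unrank eq) (unrank-rank y))

module _ {m : ℕ} (C : LinearCode m) where

  -- Counting replaces the exchange lemma: the 2^k combinations of `A` are distinct codewords, and
  -- choosing coordinates of each with respect to `B` injects them into the 2^l coordinate vectors.
  independent≤spanning : ∀ {k l} {A : Vec (F₂^ m) k} {B : Vec (F₂^ m) l} →
    All (Codeword C) A → Independent A → Spans C B → k ≤ l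
  independent≤spanning {k} {l} {A} {B} mem ind span =
    ℕ.≮⇒≥ λ l<k → ℕ.<⇒≱ (ℕ.^-monoʳ-< 2 (s≤s (s≤s z≤n)) l<k) (Fin.injective⇒≤ coordinates-injective)
    where
    inSpan : ∀ a → ∃[ b ] linearCombination b B ≡ linearCombination a A
    inSpan a = span _ (linearCombination-closed C mem a)
    coordinates : Fin (2 ^ k) → F₂^ l
    coordinates i = proj₁ (inSpan (unrank i))
    coordinates-injective : Injective _≡_ _≡_ (rank ∘ coordinates)
    coordinates-injective {i} {j} eq = unrank-injective {k} (independent⇒injective ind
      (trans (sym (proj₂ (inSpan (unrank i))))
        (trans (cong (λ b → linearCombination b B) (rank-injective {x = coordinates i} {coordinates j} eq))
          (proj₂ (inSpan (unrank j))))))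

  -- `dim` comes from one basis found by search, whereas the transversal needs a basis adapted to
  -- C_L and C_R; this compares the two.
  dimension-unique : ∀ {k l} → HasDimension C k → HasDimension C l → k ≡ l
  dimension-unique (_ , A) (_ , B) = ℕ.≤-antisym
    (independent≤spanning (members A) (independent A) (spanning B))
    (independent≤spanning (members B) (independent B) (spanning A))
    where open IsBasis

  InSpan : ∀ {k} → Vec (F₂^ m) k → F₂^ m → Set
  InSpan B x = ∃[ a ] linearCombination a B ≡ x

  inSpan? : ∀ {k} (B : Vec (F₂^ m) k) x → Dec (InSpan B x)
  inSpan? B x = map′ (λ (i , eq) → unrank i , eq)
    (λ (a , eq) → rank a , trans (cong (λ b → linearCombination b B) (unrank-rank a)) eq)
    (Fin.any? λ i → Vec.≡-dec Bool._≟_ (linearCombination (unrank i) B) x)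

  adjoin : ∀ {k} {B : Vec (F₂^ m) k} {x} → ¬ InSpan B x → Independent B → Independent (x ∷ B)
  adjoin {B = B} {x} x∉ ind (false ∷ a) eq =
    cong (false ∷_) (ind a (trans (sym (linearCombination-false a x B)) eq))
  adjoin {B = B} {x} x∉ ind (true ∷ a) eq =
    contradiction (a , sym (x⊕y≡𝟘⇒x≡y x _ (trans (sym (linearCombination-true a x B)) eq))) x∉

  -- Greedy extension by the vectors of a list. `B` stays a suffix throughout, so the added vectors
  -- `E′` can afterwards be separated from it.
  extend : ∀ {l} {B : Vec (F₂^ m) l} (xs : List (F₂^ m)) {k} (E : Vec (F₂^ m) k) →
    All (Codeword C) (E ++ B) → Independent (E ++ B) →
    ∃[ e ] Σ[ E′ ∈ Vec (F₂^ m) e ] All (Codeword C) (E′ ++ B) × Independent (E′ ++ B)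
      × (∀ x → InSpan (E ++ B) x → InSpan (E′ ++ B) x)
      × (∀ x → x ∈ xs → Codeword C x → InSpan (E′ ++ B) x)
  extend []       E mem ind = _ , E , mem , ind , (λ _ s → s) , λ _ ()
  extend {B = B} (y ∷ xs) E mem ind with codeword? C y | inSpan? (E ++ B) y
  ... | no y∉C | _ =
    let _ , E′ , mem′ , ind′ , mono , new = extend xs E mem ind
    in  _ , E′ , mem′ , ind′ , mono ,
        λ { _ (here refl) y∈C → contradiction y∈C y∉C ; x (there x∈) → new x x∈ }
  ... | yes _ | yes y∈E =
    let _ , E′ , mem′ , ind′ , mono , new = extend xs E mem ind
    in  _ , E′ , mem′ , ind′ , mono ,
        λ { _ (here refl) _ → mono y y∈E ; x (there x∈) → new x x∈ }
  ... | yes y∈C | no y∉E =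
    let _ , E′ , mem′ , ind′ , mono , new = extend xs (y ∷ E) (y∈C ∷ mem) (adjoin y∉E ind)
    in  _ , E′ , mem′ , ind′ ,
        (λ x (a , eq) → mono x (false ∷ a , trans (linearCombination-false a y (E ++ B)) eq)) ,
        λ { _ (here refl) _ → mono y (true ∷ 𝟘 , trans (linearCombination-true 𝟘 y (E ++ B))
              (trans (cong (y ⊕_) (linearCombination-𝟘 (E ++ B))) (⊕-identityʳ y)))
          ; x (there x∈) → new x x∈ }

∈-allVectors : ∀ {m} (x : F₂^ m) → x ∈ allVectors m
∈-allVectors []          = here refl
∈-allVectors (false ∷ x) = ∈.∈-++⁺ˡ (∈.∈-map⁺ (false ∷_) (∈-allVectors x))
∈-allVectors (true  ∷ x) = ∈.∈-++⁺ʳ (List.map (false ∷_) (allVectors _)) (∈.∈-map⁺ (true ∷_) (∈-allVectors x))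

extendToBasis : ∀ {m} (C : LinearCode m) {l} {B : Vec (F₂^ m) l} → All (Codeword C) B → Independent B →
  ∃[ e ] Σ[ E ∈ Vec (F₂^ m) e ] IsBasis C (E ++ B)
extendToBasis C mem ind =
  let e , E , mem′ , ind′ , _ , spans = extend C (allVectors _) [] mem ind
  in  e , E , record
        { members = mem′ ; independent = ind′ ; spanning = λ x → spans x (∈-allVectors x) }

-- Weights, restrictions and the decoding matrix

weight≡0⇒≡𝟘 : ∀ {m} (x : F₂^ m) → weight x ≡ 0 → x ≡ 𝟘
weight≡0⇒≡𝟘 []          _  = refl
weight≡0⇒≡𝟘 (false ∷ x) eq = cong (false ∷_) (weight≡0⇒≡𝟘 x eq)

weight-𝟘 : ∀ m → weight (𝟘 {m}) ≡ 0
weight-𝟘 zero    = refl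
weight-𝟘 (suc m) = weight-𝟘 m

weight[x⊕x] : ∀ {m} (x : F₂^ m) → weight (x ⊕ x) ≡ 0
weight[x⊕x] {m} x = trans (cong weight (⊕-self x)) (weight-𝟘 m)

restrict-⊕ : ∀ {m} (S : Subset m) x y → restrict S (x ⊕ y) ≡ restrict S x ⊕ restrict S y
restrict-⊕ []            []      []      = refl
restrict-⊕ (inside  ∷ S) (a ∷ x) (b ∷ y) = cong ((a xor b) ∷_) (restrict-⊕ S x y)
restrict-⊕ (outside ∷ S) (a ∷ x) (b ∷ y) = restrict-⊕ S x y

restrict≡𝟘⇒≡𝟘 : ∀ {m} (S : Subset m) (x : F₂^ m) → restrict S x ≡ 𝟘 → restrict (∁ S) x ≡ 𝟘 → x ≡ 𝟘
restrict≡𝟘⇒≡𝟘 []            []      _  _  = refl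
restrict≡𝟘⇒≡𝟘 (inside  ∷ S) (a ∷ x) p q =
  cong₂ _∷_ (Vec.∷-injectiveˡ p) (restrict≡𝟘⇒≡𝟘 S x (Vec.∷-injectiveʳ p) q)
restrict≡𝟘⇒≡𝟘 (outside ∷ S) (a ∷ x) p q =
  cong₂ _∷_ (Vec.∷-injectiveˡ q) (restrict≡𝟘⇒≡𝟘 S x p (Vec.∷-injectiveʳ q))

weight-glue-⊕ : ∀ {m} (S : Subset m) x y (c : F₂^ m) →
  weight (glue S x y ⊕ c) ≡ weight (x ⊕ restrict S c) + weight (y ⊕ restrict (∁ S) c)
weight-glue-⊕ []            [] [] [] = refl
weight-glue-⊕ (inside ∷ S) (a ∷ x) y (b ∷ c) with a xor b
... | true  = cong suc (weight-glue-⊕ S x y c)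
... | false = weight-glue-⊕ S x y c
weight-glue-⊕ (outside ∷ S) x (a ∷ y) (b ∷ c) with a xor b
... | true  = trans (cong suc (weight-glue-⊕ S x y c)) (sym (ℕ.+-suc _ _))
... | false = weight-glue-⊕ S x y c

module _ {m} (C : LinearCode m) (L : Subset m) where

  decoding-≤ : ∀ x y {c} → Codeword C c →
    decodingMatrix C L x y ≤ weight (x ⊕ restrict L c) + weight (y ⊕ restrict (∁ L) c)
  decoding-≤ x y {c} c∈C = subst (decodingMatrix C L x y ≤_) (weight-glue-⊕ L x y c)
    (ListAll.lookup (Extrema.min≤xs _ _)
      (∈.∈-map⁺ (λ c → weight (glue L x y ⊕ c)) (∈.∈-filter⁺ (codeword? C) (∈-allVectors c) c∈C)))

  decoding-attained : ∀ x y → ∃[ c ] Codeword C c ×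
    decodingMatrix C L x y ≡ weight (x ⊕ restrict L c) + weight (y ⊕ restrict (∁ L) c)
  decoding-attained x y with Extrema.argmin-sel id (weight (glue L x y ⊕ 𝟘))
    (List.map (λ c → weight (glue L x y ⊕ c)) (List.filter (codeword? C) (allVectors m)))
  -- The default value of the minimum is the distance to the codeword 𝟘, so this case yields a
  -- codeword too.
  ... | inj₁ eq = 𝟘 , 𝟘-closed C , trans eq (weight-glue-⊕ L x y 𝟘)
  ... | inj₂ ∈xs with ∈.∈-map⁻ (λ c → weight (glue L x y ⊕ c)) ∈xs
  ...   | c , c∈ , eq = c , proj₂ (∈.∈-filter⁻ (codeword? C) {xs = allVectors m} c∈) , trans eq (weight-glue-⊕ L x y c)

-- Cosets of C_L ⊕ C_R in C and the distances to them

module _ {m} (C : LinearCode m) (L : Subset m) where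

  private
    module L = LinearCode (vanishingOn (∁ L) C)
    module R = LinearCode (vanishingOn L C)

  -- The sum of C_L and C_R in C is direct, since a word vanishing on L and on
  -- its complement is 𝟘.
  independent-++ : ∀ {k l} {A : Vec (F₂^ m) k} {B : Vec (F₂^ m) l} →
    All L.Codeword A → All R.Codeword B → Independent A → Independent B → Independent (A ++ B)
  independent-++ {k} {A = A} {B} A⊆L B⊆R indA indB ab eq with Vec.splitAt k ab
  ... | a , b , refl = trans (cong₂ _++_ (indA a x≡𝟘) (indB b (trans (sym x≡y) x≡𝟘))) (𝟘++𝟘 k)
    where
    x = linearCombination a A
    y = linearCombination b B
    x≡y : x ≡ y
    x≡y = x⊕y≡𝟘⇒x≡y x y (trans (sym (linearCombination-++ a b A B)) eq)
    x≡𝟘 : x ≡ 𝟘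
    x≡𝟘 = restrict≡𝟘⇒≡𝟘 L x
      (trans (cong (restrict L) x≡y) (proj₂ (linearCombination-closed (vanishingOn L C) B⊆R b)))
      (proj₂ (linearCombination-closed (vanishingOn (∁ L) C) A⊆L a))
    𝟘++𝟘 : ∀ k {l} → 𝟘 {k} ++ 𝟘 {l} ≡ 𝟘
    𝟘++𝟘 zero    = refl
    𝟘++𝟘 (suc k) = cong (false ∷_) (𝟘++𝟘 k)

  -- Representatives of C / (C_L ⊕ C_R).
  record Transversal (n : ℕ) : Set where
    field
      rep       : Fin n → F₂^ m
      rep∈      : ∀ t → Codeword C (rep t)
      decompose : ∀ {x} → Codeword C x → ∃[ t ] ∃₂ λ a b →
                  L.Codeword a × R.Codeword b × x ≡ rep t ⊕ (a ⊕ b)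
      separated : ∀ t t′ {a b} → L.Codeword a → R.Codeword b → rep t ≡ rep t′ ⊕ (a ⊕ b) → t ≡ t′

  -- The bases `A` of C_L and `B` of C_R together are independent, so some `E` completes them to a
  -- basis of C. The combinations of `E` alone meet every coset of C_L ⊕ C_R exactly once.
  transversal : ∀ {k l r} → HasDimension C k →
    HasDimension (vanishingOn (∁ L) C) l → HasDimension (vanishingOn L C) r → Transversal (2 ^ (k ∸ l ∸ r))
  transversal {k} {l} {r} dimC (A , basisA) (B , basisB)
    with extendToBasis C
           (All.++⁺ (All.map proj₁ (IsBasis.members basisA)) (All.map proj₁ (IsBasis.members basisB)))
           (independent-++ (IsBasis.members basisA) (IsBasis.members basisB)
             (IsBasis.independent basisA) (IsBasis.independent basisB))
  ... | e , E , basis = subst (λ n → Transversal (2 ^ n)) e≡ record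
    { rep       = λ t → linearCombination (unrank t) E
    ; rep∈      = λ t → linearCombination-closed C (All.++ˡ⁻ E (IsBasis.members basis)) (unrank t)
    ; decompose = decompose
    ; separated = separated
    }
    where
    e≡ : e ≡ k ∸ l ∸ r
    -- The adapted basis gives k = e + (l + r), so the subtractions in the exponent are never
    -- truncated.
    e≡ = sym (trans (cong (λ k → k ∸ l ∸ r) (dimension-unique C dimC (E ++ (A ++ B) , basis)))
      (trans (ℕ.∸-+-assoc (e + (l + r)) l r) (ℕ.m+n∸n≡m e (l + r))))
    lc-split : ∀ t a b → linearCombination (t ++ (a ++ b)) (E ++ (A ++ B)) ≡
      linearCombination t E ⊕ (linearCombination a A ⊕ linearCombination b B)
    lc-split t a b = trans (linearCombination-++ t (a ++ b) E (A ++ B)) (cong (_ ⊕_) (linearCombination-++ a b A B))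
    decompose : ∀ {x} → Codeword C x → ∃[ t ] ∃₂ λ a b →
      L.Codeword a × R.Codeword b × x ≡ linearCombination (unrank t) E ⊕ (a ⊕ b)
    decompose {x} x∈C with IsBasis.spanning basis x x∈C
    ... | tab , eq with Vec.splitAt e tab
    ...   | t , ab , refl with Vec.splitAt l ab
    ...     | a , b , refl = rank t , linearCombination a A , linearCombination b B ,
      linearCombination-closed (vanishingOn (∁ L) C) (IsBasis.members basisA) a ,
      linearCombination-closed (vanishingOn L C) (IsBasis.members basisB) b ,
      trans (sym eq) (trans (lc-split t a b)
        (cong (λ t → linearCombination t E ⊕ _) (sym (unrank-rank t))))
    separated : ∀ t t′ {a b} → L.Codeword a → R.Codeword b →
      linearCombination (unrank t) E ≡ linearCombination (unrank t′) E ⊕ (a ⊕ b) → t ≡ t′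
    separated t t′ {a} {b} a∈ b∈ eq with IsBasis.spanning basisA a a∈ | IsBasis.spanning basisB b b∈
    -- Coordinates in the adapted basis are unique: those of the left side are `unrank t` followed
    -- by 𝟘, those of the right side `unrank t′` followed by `α` and `β`. The blocks belonging to
    -- `E` agree.
    ... | α , refl | β , refl = unrank-injective {e} (Vec.++-injectiveˡ (unrank t) (unrank t′)
      (independent⇒injective (IsBasis.independent basis)
        (trans (linearCombination-++ (unrank t) 𝟘 E (A ++ B))
          (trans (trans (cong (_ ⊕_) (linearCombination-𝟘 (A ++ B))) (⊕-identityʳ _))
            (trans eq (sym (lc-split (unrank t′) α β)))))))

  module _ {n} (T : Transversal n) where
    open Transversal T

    -- The distance from `x` to the coset (c_t)_L + C_L, translated by (c_t)_L. Words of C_L vanish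
    -- outside L, so against 𝟘 on that side the decoding matrix of C_L measures only the part on L.
    leftDistance : Fin n → F₂^ ∣ L ∣ → ℕ
    leftDistance t x = decodingMatrix (vanishingOn (∁ L) C) L (x ⊕ restrict L (rep t)) 𝟘

    rightDistance : Fin n → F₂^ ∣ ∁ L ∣ → ℕ
    rightDistance t y = decodingMatrix (vanishingOn L C) L 𝟘 (y ⊕ restrict (∁ L) (rep t))

    private
      left-part : ∀ x c {a b} → R.Codeword b →
        x ⊕ restrict L (c ⊕ (a ⊕ b)) ≡ (x ⊕ restrict L c) ⊕ restrict L a
      left-part x c {a} {b} (_ , b≡𝟘) = begin
        x ⊕ restrict L (c ⊕ (a ⊕ b))                      ≡⟨ cong (x ⊕_) (restrict-⊕ L c (a ⊕ b)) ⟩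
        x ⊕ (restrict L c ⊕ restrict L (a ⊕ b))           ≡⟨ ⊕-assoc x _ _ ⟨
        (x ⊕ restrict L c) ⊕ restrict L (a ⊕ b)           ≡⟨ cong (_ ⊕_) (restrict-⊕ L a b) ⟩
        (x ⊕ restrict L c) ⊕ (restrict L a ⊕ restrict L b) ≡⟨ cong (λ b → _ ⊕ (_ ⊕ b)) b≡𝟘 ⟩
        (x ⊕ restrict L c) ⊕ (restrict L a ⊕ 𝟘)            ≡⟨ cong (_ ⊕_) (⊕-identityʳ _) ⟩
        (x ⊕ restrict L c) ⊕ restrict L a                  ∎
        where open ≡-Reasoning

      right-part : ∀ y c {a b} → L.Codeword a →
        y ⊕ restrict (∁ L) (c ⊕ (a ⊕ b)) ≡ (y ⊕ restrict (∁ L) c) ⊕ restrict (∁ L) b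
      right-part y c {a} {b} (_ , a≡𝟘) = begin
        y ⊕ restrict (∁ L) (c ⊕ (a ⊕ b))                              ≡⟨ cong (y ⊕_) (restrict-⊕ (∁ L) c (a ⊕ b)) ⟩
        y ⊕ (restrict (∁ L) c ⊕ restrict (∁ L) (a ⊕ b))               ≡⟨ ⊕-assoc y _ _ ⟨
        (y ⊕ restrict (∁ L) c) ⊕ restrict (∁ L) (a ⊕ b)               ≡⟨ cong (_ ⊕_) (restrict-⊕ (∁ L) a b) ⟩
        (y ⊕ restrict (∁ L) c) ⊕ (restrict (∁ L) a ⊕ restrict (∁ L) b) ≡⟨ cong (λ a → _ ⊕ (a ⊕ _)) a≡𝟘 ⟩
        (y ⊕ restrict (∁ L) c) ⊕ (𝟘 ⊕ restrict (∁ L) b)                ≡⟨ cong (_ ⊕_) (⊕-identityˡ _) ⟩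
        (y ⊕ restrict (∁ L) c) ⊕ restrict (∁ L) b                      ∎
        where open ≡-Reasoning

      weight[𝟘⊕𝟘] : ∀ {k} {z : F₂^ k} → z ≡ 𝟘 → weight (𝟘 ⊕ z) ≡ 0
      weight[𝟘⊕𝟘] {k} refl = weight[x⊕x] (𝟘 {k})

    decoding≤distances : ∀ t x y → decodingMatrix C L x y ≤ leftDistance t x + rightDistance t y
    decoding≤distances t x y
      with decoding-attained (vanishingOn (∁ L) C) L (x ⊕ restrict L (rep t)) 𝟘
         | decoding-attained (vanishingOn L C) L 𝟘 (y ⊕ restrict (∁ L) (rep t))
    ... | a , a∈ , u≡ | b , b∈ , v≡ = begin
      decodingMatrix C L x y
        ≤⟨ decoding-≤ C L x y (⊕-closed C (rep∈ t) (⊕-closed C (proj₁ a∈) (proj₁ b∈))) ⟩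
      weight (x ⊕ restrict L (rep t ⊕ (a ⊕ b))) + weight (y ⊕ restrict (∁ L) (rep t ⊕ (a ⊕ b)))
        ≡⟨ cong₂ (λ x y → weight x + weight y) (left-part x (rep t) b∈) (right-part y (rep t) a∈) ⟩
      weight (x ⊕ restrict L (rep t) ⊕ restrict L a) + weight (y ⊕ restrict (∁ L) (rep t) ⊕ restrict (∁ L) b)
        -- The added weights are those of `a` outside L and of `b` on L. They complete the two
        -- distances; an inequality suffices in this direction.
        ≤⟨ ℕ.+-mono-≤ (ℕ.m≤m+n (weight (x ⊕ restrict L (rep t) ⊕ restrict L a)) _)
                      (ℕ.m≤n+m (weight (y ⊕ restrict (∁ L) (rep t) ⊕ restrict (∁ L) b)) (weight (𝟘 ⊕ restrict L b))) ⟩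
      (weight (x ⊕ restrict L (rep t) ⊕ restrict L a) + weight (𝟘 ⊕ restrict (∁ L) a))
        + (weight (𝟘 ⊕ restrict L b) + weight (y ⊕ restrict (∁ L) (rep t) ⊕ restrict (∁ L) b))
        ≡⟨ cong₂ _+_ u≡ v≡ ⟨
      leftDistance t x + rightDistance t y ∎
      where open ℕ.≤-Reasoning

    distances≤decoding : ∀ x y → ∃[ t ] leftDistance t x + rightDistance t y ≤ decodingMatrix C L x y
    distances≤decoding x y with decoding-attained C L x y
    ... | c , c∈ , W≡ with decompose c∈
    ...   | t , a , b , a∈ , b∈ , refl = t , (begin
      leftDistance t x + rightDistance t y
        ≤⟨ ℕ.+-mono-≤ (decoding-≤ (vanishingOn (∁ L) C) L _ 𝟘 a∈) (decoding-≤ (vanishingOn L C) L 𝟘 _ b∈) ⟩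
      (weight (x ⊕ restrict L (rep t) ⊕ restrict L a) + weight (𝟘 ⊕ restrict (∁ L) a))
        + (weight (𝟘 ⊕ restrict L b) + weight (y ⊕ restrict (∁ L) (rep t) ⊕ restrict (∁ L) b))
        ≡⟨ cong₂ _+_
             (trans (cong (weight (x ⊕ restrict L (rep t) ⊕ restrict L a) +_) (weight[𝟘⊕𝟘] (proj₂ a∈)))
               (ℕ.+-identityʳ (weight (x ⊕ restrict L (rep t) ⊕ restrict L a))))
             (cong (_+ weight (y ⊕ restrict (∁ L) (rep t) ⊕ restrict (∁ L) b)) (weight[𝟘⊕𝟘] (proj₂ b∈))) ⟩
      weight (x ⊕ restrict L (rep t) ⊕ restrict L a) + weight (y ⊕ restrict (∁ L) (rep t) ⊕ restrict (∁ L) b)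
        ≡⟨ cong₂ (λ x y → weight x + weight y) (left-part x (rep t) b∈) (right-part y (rep t) a∈) ⟨
      weight (x ⊕ restrict L (rep t ⊕ (a ⊕ b))) + weight (y ⊕ restrict (∁ L) (rep t ⊕ (a ⊕ b)))
        ≡⟨ W≡ ⟨
      decodingMatrix C L x y ∎)
      where open ℕ.≤-Reasoning

    decoding-diagonal : ∀ t → decodingMatrix C L (restrict L (rep t)) (restrict (∁ L) (rep t)) ≡ 0
    decoding-diagonal t = ℕ.n≤0⇒n≡0 (ℕ.≤-trans
      (decoding-≤ C L (restrict L (rep t)) (restrict (∁ L) (rep t)) (rep∈ t))
      (ℕ.≤-reflexive (cong₂ _+_ (weight[x⊕x] (restrict L (rep t))) (weight[x⊕x] (restrict (∁ L) (rep t))))))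

    -- A codeword c agreeing with rep i on L and with rep j outside L gives
    -- rep i ≡ rep j ⊕ (a ⊕ b) with a = rep j ⊕ c in C_L and b = rep i ⊕ c in C_R.
    decoding-offDiagonal : ∀ i j → decodingMatrix C L (restrict L (rep i)) (restrict (∁ L) (rep j)) ≡ 0 → i ≡ j
    decoding-offDiagonal i j W≡0 with decoding-attained C L (restrict L (rep i)) (restrict (∁ L) (rep j))
    ... | c , c∈ , W≡ = separated i j {rep j ⊕ c} {rep i ⊕ c}
      (⊕-closed C (rep∈ j) c∈ , trans (restrict-⊕ (∁ L) (rep j) c)
        (weight≡0⇒≡𝟘 _ (ℕ.m+n≡0⇒n≡0 (weight (restrict L (rep i) ⊕ restrict L c)) (trans (sym W≡) W≡0))))
      (⊕-closed C (rep∈ i) c∈ , trans (restrict-⊕ L (rep i) c)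
        (weight≡0⇒≡𝟘 _ (ℕ.m+n≡0⇒m≡0 _ (trans (sym W≡) W≡0))))
      (sym (trans (cong (rep j ⊕_) (⊕-assoc (rep j) c (rep i ⊕ c)))
        (trans (x⊕[x⊕y]≡y (rep j) _) (trans (x⊕yz≡y⊕xz c (rep i) c)
          (trans (cong (rep i ⊕_) (⊕-self c)) (⊕-identityʳ (rep i)))))))

-- Real numbers

ℚ<⇒≱ : ∀ {p q} → p ℚ.< q → ¬ q ℚ.≤ p
ℚ<⇒≱ p<q q≤p = ℚ.<-irrefl refl (ℚ.<-≤-trans p<q q≤p)

p<p+ε : ∀ p {ε} → 0ℚ ℚ.< ε → p ℚ.< p ℚ.+ ε
p<p+ε p {ε} 0<ε = subst (ℚ._< p ℚ.+ ε) (ℚ.+-identityʳ p) (ℚ.+-monoʳ-< p 0<ε)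

fromℕℚ : ℕ → ℚ
fromℕℚ n = ℤ.+ n ℚ./ 1

-- Compared as unnormalised fractions, where the denominators are visibly 1 and no gcd has to be
-- evaluated.
fromℕℚ-+ : ∀ m n → fromℕℚ (m ℕ.+ n) ≡ fromℕℚ m ℚ.+ fromℕℚ n
fromℕℚ-+ m n = ℚ.toℚᵘ-injective (begin
  ℚ.toℚᵘ (fromℕℚ (m ℕ.+ n))             ≈⟨ ℚ.toℚᵘ-fromℚᵘ (ℚᵘ.mkℚᵘ (ℤ.+ (m ℕ.+ n)) 0) ⟩
  ℚᵘ.mkℚᵘ (ℤ.+ (m ℕ.+ n)) 0                ≈⟨ ℚᵘ.*≡* (cong (ℤ._* ℤ.+ 1)
                                             (cong₂ ℤ._+_ (sym (ℤ.*-identityʳ (ℤ.+ m))) (sym (ℤ.*-identityʳ (ℤ.+ n))))) ⟩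
  ℚᵘ.mkℚᵘ (ℤ.+ m) 0 ℚᵘ.+ ℚᵘ.mkℚᵘ (ℤ.+ n) 0   ≈⟨ ℚᵘ.+-cong (ℚ.toℚᵘ-fromℚᵘ (ℚᵘ.mkℚᵘ (ℤ.+ m) 0))
                                             (ℚ.toℚᵘ-fromℚᵘ (ℚᵘ.mkℚᵘ (ℤ.+ n) 0)) ⟨
  ℚ.toℚᵘ (fromℕℚ m) ℚᵘ.+ ℚ.toℚᵘ (fromℕℚ n) ≈⟨ ℚ.toℚᵘ-homo-+ (fromℕℚ m) (fromℕℚ n) ⟨
  ℚ.toℚᵘ (fromℕℚ m ℚ.+ fromℕℚ n)        ∎)
  where open ℚᵘ.≃-Reasoning

fromℕℚ-mono-≤ : ∀ {m n} → m ℕ.≤ n → fromℕℚ m ℚ.≤ fromℕℚ n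
fromℕℚ-mono-≤ {m} {n} m≤n with ℕ.m≤n⇒∃[o]m+o≡n m≤n
... | o , refl = subst₂ ℚ._≤_ (ℚ.+-identityʳ _) (sym (fromℕℚ-+ m o))
  (ℚ.+-monoʳ-≤ (fromℕℚ m) (ℚ.nonNegative⁻¹ (fromℕℚ o) {{ℚ.normalize-nonNeg o 1}}))

fromℕℚ-mono-< : ∀ {m n} → m ℕ.< n → fromℕℚ m ℚ.< fromℕℚ n
fromℕℚ-mono-< {m} {suc n} (ℕ.s≤s m≤n) = ℚ.≤-<-trans (fromℕℚ-mono-≤ m≤n)
  (subst₂ ℚ._<_ (ℚ.+-identityˡ _) (sym (fromℕℚ-+ 1 n)) (ℚ.+-monoˡ-< (fromℕℚ n) (ℚ.positive⁻¹ 1ℚ)))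

fromℕℚ-cancel-≤ : ∀ {m n} → fromℕℚ m ℚ.≤ fromℕℚ n → m ℕ.≤ n
fromℕℚ-cancel-≤ m≤n = ℕ.≮⇒≥ λ n<m → ℚ<⇒≱ (fromℕℚ-mono-< n<m) m≤n

p≤∣p∣ : ∀ p → p ℚ.≤ ℚ.∣ p ∣
p≤∣p∣ p with ℚ.≤-total 0ℚ p
... | inj₁ 0≤p = ℚ.≤-reflexive (sym (ℚ.0≤p⇒∣p∣≡p 0≤p))
... | inj₂ p≤0 = ℚ.≤-trans p≤0 (ℚ.0≤∣p∣ p)

∣p∣< : ∀ {p ε} → p ℚ.< ε → ℚ.- p ℚ.< ε → ℚ.∣ p ∣ ℚ.< ε
∣p∣< {p} p<ε -p<ε with ℚ.∣p∣≡p∨∣p∣≡-p p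
... | inj₁ eq = subst (ℚ._< _) (sym eq) p<ε
... | inj₂ eq = subst (ℚ._< _) (sym eq) -p<ε

halve : ∀ {ε} → 0ℚ ℚ.< ε → ∃[ δ ] 0ℚ ℚ.< δ × δ ℚ.+ δ ≡ ε
halve {ε} 0<ε = ε ℚ.* ½ , ℚ.positive⁻¹ (ε ℚ.* ½) {{ℚ.pos*pos⇒pos ε {{ℚ.positive 0<ε}} ½}} ,
  trans (sym (ℚ.*-distribˡ-+ ε ½ ½)) (ℚ.*-identityʳ ε)

p<q+ε⇒p-q<ε : ∀ {p q ε} → p ℚ.< q ℚ.+ ε → p ℚ.- q ℚ.< ε
p<q+ε⇒p-q<ε {p} {q} {ε} h = subst (p ℚ.- q ℚ.<_)
  (solve 2 (λ q e → (q :+ e) :- q := e) refl q ε) (ℚ.+-monoˡ-< (ℚ.- q) h)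

p-q<ε⇒p<q+ε : ∀ {p q ε} → p ℚ.- q ℚ.< ε → p ℚ.< q ℚ.+ ε
p-q<ε⇒p<q+ε {p} {q} {ε} h = subst (ℚ._< q ℚ.+ ε)
  (solve 2 (λ q p → q :+ (p :- q) := p) refl q p) (ℚ.+-monoʳ-< q h)

-[p-q]≡q-p : ∀ p q → ℚ.- (p ℚ.- q) ≡ q ℚ.- p
-[p-q]≡q-p = solve 2 (λ p q → :- (p :- q) := q :- p) refl

always : {P : ℕ → Set} → (∀ n → P n) → Eventually P
always p = 0 , λ n _ → p n

eventually : {P Q : ℕ → Set} → (∀ {n} → P n → Q n) → Eventually P → Eventually Q
eventually f (N , p) = N , λ n N≤n → f (p n N≤n)

eventually₂ : {P Q R : ℕ → Set} → (∀ {n} → P n → Q n → R n) → Eventually P → Eventually Q → Eventually R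
eventually₂ f (M , p) (N , q) = M ⊔ N , λ n ≤n →
  f (p n (ℕ.m⊔n≤o⇒m≤o M N ≤n)) (q n (ℕ.m⊔n≤o⇒n≤o M N ≤n))

now : {P : Set} → Eventually (λ _ → P) → P
now (N , p) = p N ℕ.≤-refl

infix 4 _≃_ _≲_

-- Wrappers of _≈ᵣ_ and _≤ᵣ_, which unfold and so do not determine their two
-- sides. Arguments of the form x +ᵣ y are given explicitly throughout, as _+ᵣ_ is
-- defined by copatterns and unification would compare proofs of Cauchyness.
record _≃_ (x y : ℝ) : Set where
  constructor ⟪_⟫
  field ≈ : x ≈ᵣ y

record _≲_ (x y : ℝ) : Set where
  constructor ⟪_⟫
  field ≤ : x ≤ᵣ y

≃-setoid : Setoid 0ℓ 0ℓ
≃-setoid = record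
  { _≈_ = _≃_
  ; isEquivalence = record
    { refl  = λ {x} → ⟪ ≈.refl {x} ⟫
    ; sym   = λ { {x} {y} ⟪ p ⟫ → ⟪ ≈.sym {x} {y} p ⟫ }
    ; trans = λ { {x} {y} {z} ⟪ p ⟫ ⟪ q ⟫ → ⟪ ≈.trans {x} {y} {z} p q ⟫ }
    }
  }
  where module ≈ = IsEquivalence ≈ᵣ-isEquivalence

open Setoid ≃-setoid public using () renaming (refl to ≃-refl; sym to ≃-sym; trans to ≃-trans)

-- The operations on reals act termwise on sequences, so this reduces every ring identity of ℝ to
-- one of ℚ.
pointwise : ∀ {x y} → (∀ n → seq x n ≡ seq y n) → x ≃ y
pointwise {x} {y} eq = ⟪ (λ ε 0<ε → always λ n → subst (λ p → ℚ.∣ p ∣ ℚ.< ε)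
  (sym (trans (cong (ℚ._- seq y n) (eq n)) (ℚ.+-inverseʳ (seq y n)))) 0<ε) ⟫

≃⇒≲ : ∀ {x y} → x ≃ y → x ≲ y
≃⇒≲ ⟪ x≈y ⟫ = ⟪ (λ ε 0<ε → eventually (λ h → p-q<ε⇒p<q+ε (ℚ.≤-<-trans (p≤∣p∣ _) h)) (x≈y ε 0<ε)) ⟫

≲-antisym : ∀ {x y} → x ≲ y → y ≲ x → x ≃ y
≲-antisym {x} {y} ⟪ x≤y ⟫ ⟪ y≤x ⟫ = ⟪ (λ ε 0<ε → eventually₂
  (λ {n} p q → ∣p∣< (p<q+ε⇒p-q<ε p)
    (subst (ℚ._< ε) (sym (-[p-q]≡q-p (seq x n) (seq y n))) (p<q+ε⇒p-q<ε q)))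
  (x≤y ε 0<ε) (y≤x ε 0<ε)) ⟫

≲-trans : ∀ {x y z} → x ≲ y → y ≲ z → x ≲ z
≲-trans {x} {y} {z} ⟪ x≤y ⟫ ⟪ y≤z ⟫ = ⟪ (λ ε 0<ε → let δ , 0<δ , 2δ≡ε = halve 0<ε in eventually₂
  (λ {n} p q → subst (seq x n ℚ.<_) (trans (ℚ.+-assoc (seq z n) δ δ) (cong (seq z n ℚ.+_) 2δ≡ε))
    (ℚ.<-trans p (ℚ.+-monoˡ-< δ q)))
  (x≤y δ 0<δ) (y≤z δ 0<δ)) ⟫

+-mono-≲ : ∀ {x y z w} → x ≲ y → z ≲ w → x +ᵣ z ≲ y +ᵣ w
+-mono-≲ {x} {y} {z} {w} ⟪ x≤y ⟫ ⟪ z≤w ⟫ = ⟪ (λ ε 0<ε → let δ , 0<δ , 2δ≡ε = halve 0<ε in eventually₂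
  (λ {n} p q → subst (seq x n ℚ.+ seq z n ℚ.<_)
    (trans (solve 3 (λ y w d → (y :+ d) :+ (w :+ d) := (y :+ w) :+ (d :+ d)) refl (seq y n) (seq w n) δ)
      (cong (seq y n ℚ.+ seq w n ℚ.+_) 2δ≡ε))
    (ℚ.+-mono-< p q))
  (x≤y δ 0<δ) (z≤w δ 0<δ)) ⟫

≲-poset : Poset 0ℓ 0ℓ 0ℓ
≲-poset = record
  { _≤_ = _≲_
  ; isPartialOrder = record
    { isPreorder = record
      { isEquivalence = Setoid.isEquivalence ≃-setoid ; reflexive = ≃⇒≲ ; trans = ≲-trans }
    ; antisym = ≲-antisym
    }
  }

module ≲-Reasoning = PosetReasoning ≲-poset

<⇒≲ : ∀ {x y} → x <ᵣ y → x ≲ y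
<⇒≲ {x} {y} (δ , 0<δ , x<y) = ⟪ (λ ε 0<ε → eventually
  (λ {n} h → ℚ.<-trans (p<p+ε (seq x n) 0<δ) (ℚ.<-trans h (p<p+ε (seq y n) 0<ε))) x<y) ⟫

<⇒⋦ : ∀ {x y} → x <ᵣ y → ¬ y ≲ x
<⇒⋦ (δ , 0<δ , x<y) ⟪ y≤x ⟫ = now (eventually₂ (λ p q → ℚ.<-asym p q) x<y (y≤x δ 0<δ))

-- Let η = ε/4 and let N be an index after which x - y varies by less than η. A rational comparison
-- at N decides: below 2η, all later differences stay below 3η < ε; otherwise they all exceed η,
-- which would be a witness of `y <ᵣ x`.
≮⇒≳ : ∀ {x y} → ¬ y <ᵣ x → x ≲ y
≮⇒≳ {x} {y} y≮x = ⟪ (λ ε 0<ε →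
  let κ , 0<κ , 2κ≡ε = halve 0<ε
      η , 0<η , 2η≡κ = halve 0<κ
      N , near       = cauchy (x -ᵣ y) η 0<η
  in  cases (seq x) (seq y) N 0<η
        (λ n N≤n → ℚ.≤-<-trans (p≤∣p∣ _) (near n N N≤n ℕ.≤-refl) , ℚ.≤-<-trans (p≤∣p∣ _) (near N n ℕ.≤-refl N≤n))
        (trans (cong₂ ℚ._+_ 2η≡κ 2η≡κ) 2κ≡ε)
        (λ h → y≮x (η , 0<η , h))) ⟫
  where
  cases : ∀ (x y : ℕ → ℚ) N {η ε} → 0ℚ ℚ.< η →
    (∀ n → N ℕ.≤ n → (x n ℚ.- y n) ℚ.- (x N ℚ.- y N) ℚ.< η × (x N ℚ.- y N) ℚ.- (x n ℚ.- y n) ℚ.< η) →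
    (η ℚ.+ η) ℚ.+ (η ℚ.+ η) ≡ ε →
    ¬ (Eventually λ n → y n ℚ.+ η ℚ.< x n) →
    Eventually λ n → x n ℚ.< y n ℚ.+ ε
  cases x y N {η} 0<η near refl y≮x = case (x N ℚ.- y N ℚ.<? η ℚ.+ η) of λ
    { (yes z<κ) → N , λ n N≤n → p-q<ε⇒p<q+ε (ℚ.<-trans
        (p-q<ε⇒p<q+ε (proj₁ (near n N≤n)))
        (ℚ.+-mono-< z<κ (p<p+ε η 0<η)))
    ; (no z≮κ) → contradiction (N , λ n N≤n → subst₂ ℚ._<_
        (solve 2 (λ y e → (y :- e) :+ (e :+ e) := y :+ e) refl (y n) η)
        (solve 3 (λ x y e → (y :- e) :+ ((x :- y) :+ e) := x) refl (x n) (y n) η)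
        (ℚ.+-monoʳ-< (y n ℚ.- η) (ℚ.≤-<-trans (ℚ.≮⇒≥ z≮κ) (p-q<ε⇒p<q+ε (proj₂ (near n N≤n)))))) y≮x }

+-cong : ∀ {x y z w} → x ≃ y → z ≃ w → x +ᵣ z ≃ y +ᵣ w
+-cong x≃y z≃w = ≲-antisym (+-mono-≲ (≃⇒≲ x≃y) (≃⇒≲ z≃w))
  (+-mono-≲ (≃⇒≲ (≃-sym x≃y)) (≃⇒≲ (≃-sym z≃w)))

x≃y⇒x-y≃0 : ∀ {x y} → x ≃ y → x -ᵣ y ≃ 0ᵣ
x≃y⇒x-y≃0 {x} {y} ⟪ x≈y ⟫ = ⟪ (λ ε 0<ε → eventually
  (λ {n} → subst (λ p → ℚ.∣ p ∣ ℚ.< ε) (sym (ℚ.+-identityʳ (seq x n ℚ.- seq y n)))) (x≈y ε 0<ε)) ⟫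

x-y≃0⇒x≃y : ∀ {x y} → x -ᵣ y ≃ 0ᵣ → x ≃ y
x-y≃0⇒x≃y {x} {y} ⟪ x-y≈0 ⟫ = ⟪ (λ ε 0<ε → eventually
  (λ {n} → subst (λ p → ℚ.∣ p ∣ ℚ.< ε) (ℚ.+-identityʳ (seq x n ℚ.- seq y n))) (x-y≈0 ε 0<ε)) ⟫

-‿cong : ∀ {x y} → x ≃ y → -ᵣ x ≃ -ᵣ y
-‿cong {x} {y} x≃y = x-y≃0⇒x≃y (≃-trans
  (pointwise λ n → solve 2 (λ x y → :- x :- :- y := y :- x) refl (seq x n) (seq y n))
  (x≃y⇒x-y≃0 (≃-sym x≃y)))

bounded : ∀ x → ∃[ B ] 0ℚ ℚ.< B × Eventually λ n → ℚ.∣ seq x n ∣ ℚ.< B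
bounded x with cauchy x 1ℚ (ℚ.positive⁻¹ 1ℚ)
... | N , near = 1ℚ ℚ.+ ℚ.∣ seq x N ∣ , ℚ.+-mono-<-≤ (ℚ.positive⁻¹ 1ℚ) (ℚ.0≤∣p∣ (seq x N)) ,
  N , λ n N≤n → ℚ.≤-<-trans
    (subst (ℚ._≤ ℚ.∣ seq x n ℚ.- seq x N ∣ ℚ.+ ℚ.∣ seq x N ∣)
      (cong ℚ.∣_∣ (solve 2 (λ a c → (a :- c) :+ c := a) refl (seq x n) (seq x N)))
      (ℚ.∣p+q∣≤∣p∣+∣q∣ (seq x n ℚ.- seq x N) (seq x N)))
    (ℚ.+-monoˡ-< ℚ.∣ seq x N ∣ (near n N N≤n ℕ.≤-refl))

∣p-0∣≡∣p∣ : ∀ p → ℚ.∣ p ℚ.- 0ℚ ∣ ≡ ℚ.∣ p ∣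
∣p-0∣≡∣p∣ p = cong ℚ.∣_∣ (ℚ.+-identityʳ p)

product-small : ∀ {B ε} → 0ℚ ℚ.< B → 0ℚ ℚ.< ε → ∃[ δ ] 0ℚ ℚ.< δ ×
  (∀ p q → ℚ.∣ p ℚ.- 0ℚ ∣ ℚ.< δ → ℚ.∣ q ∣ ℚ.< B → ℚ.∣ p ℚ.* q ℚ.- 0ℚ ∣ ℚ.< ε)
product-small {B} {ε} 0<B 0<ε = δ , 0<δ , λ p q p<δ q<B → begin-strict
    ℚ.∣ p ℚ.* q ℚ.- 0ℚ ∣    ≡⟨ ∣p-0∣≡∣p∣ (p ℚ.* q) ⟩
    ℚ.∣ p ℚ.* q ∣           ≡⟨ ℚ.∣p*q∣≡∣p∣*∣q∣ p q ⟩
    ℚ.∣ p ∣ ℚ.* ℚ.∣ q ∣     ≤⟨ ℚ.*-monoˡ-≤-nonNeg ℚ.∣ p ∣ {{ℚ.∣-∣-nonNeg p}} (ℚ.<⇒≤ q<B) ⟩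
    ℚ.∣ p ∣ ℚ.* B           <⟨ ℚ.*-monoˡ-<-pos B (subst (ℚ._< δ) (∣p-0∣≡∣p∣ p) p<δ) ⟩
    ε ℚ.* ℚ.1/ B ℚ.* B      ≡⟨ ℚ.*-assoc ε (ℚ.1/ B) B ⟩
    ε ℚ.* (ℚ.1/ B ℚ.* B)    ≡⟨ cong (ε ℚ.*_) (ℚ.*-inverseˡ B) ⟩
    ε ℚ.* 1ℚ                ≡⟨ ℚ.*-identityʳ ε ⟩
    ε                       ∎
  where
  open ℚ.≤-Reasoning
  instance
    _ = ℚ.positive 0<B
    _ = ℚ.pos⇒nonZero B
    _ = ℚ.positive 0<ε
    _ = ℚ.1/pos⇒pos B
  δ   = ε ℚ.* ℚ.1/ B
  0<δ = ℚ.positive⁻¹ δ {{ℚ.pos*pos⇒pos ε (ℚ.1/ B)}}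

x≃0⇒xy≃0 : ∀ {x} y → x ≃ 0ᵣ → x *ᵣ y ≃ 0ᵣ
x≃0⇒xy≃0 {x} y ⟪ x≈0 ⟫ = ⟪ (λ ε 0<ε →
  let B , 0<B , y<B   = bounded y
      δ , 0<δ , small = product-small 0<B 0<ε
  in  eventually₂ (λ {n} → small (seq x n) (seq y n)) (x≈0 δ 0<δ) y<B) ⟫

-- Writing the difference of the products as (x - y) z + (z - w) y leaves only products with a null
-- factor, and the other factor is bounded, being Cauchy.
*-cong : ∀ {x y z w} → x ≃ y → z ≃ w → x *ᵣ z ≃ y *ᵣ w
*-cong {x} {y} {z} {w} x≃y z≃w = x-y≃0⇒x≃y (≃-trans
  (pointwise λ n → solve 4 (λ x y z w → x :* z :- y :* w := (x :- y) :* z :+ (z :- w) :* y) refl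
    (seq x n) (seq y n) (seq z n) (seq w n))
  (≃-trans (+-cong (x≃0⇒xy≃0 z (x≃y⇒x-y≃0 x≃y)) (x≃0⇒xy≃0 y (x≃y⇒x-y≃0 z≃w)))
    (pointwise λ _ → refl)))

fromℚ-mono : ∀ {p q} → p ℚ.≤ q → fromℚ p ≲ fromℚ q
fromℚ-mono {p} {q} p≤q = ⟪ (λ ε 0<ε → always λ _ → ℚ.≤-<-trans p≤q (p<p+ε q 0<ε)) ⟫

fromℚ-cancel : ∀ {p q} → fromℚ p ≲ fromℚ q → p ℚ.≤ q
fromℚ-cancel {p} {q} ⟪ p≤q ⟫ = ℚ.≮⇒≥ λ q<p → ℚ.<-irrefl
  (solve 2 (λ p q → p := q :+ (p :- q)) refl p q)
  (now (p≤q (p ℚ.- q) (subst (ℚ._< p ℚ.- q) (ℚ.+-inverseʳ q) (ℚ.+-monoˡ-< (ℚ.- q) q<p))))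

fromℚ-injective : ∀ {p q} → fromℚ p ≃ fromℚ q → p ≡ q
fromℚ-injective p≃q = ℚ.≤-antisym (fromℚ-cancel (≃⇒≲ p≃q)) (fromℚ-cancel (≃⇒≲ (≃-sym p≃q)))

fromℕ-mono : ∀ {m n} → m ℕ.≤ n → fromℕ m ≲ fromℕ n
fromℕ-mono m≤n = fromℚ-mono (fromℕℚ-mono-≤ m≤n)

fromℕ-cancel : ∀ {m n} → fromℕ m ≲ fromℕ n → m ℕ.≤ n
fromℕ-cancel m≤n = fromℕℚ-cancel-≤ (fromℚ-cancel m≤n)

fromℕ-injective : ∀ {m n} → fromℕ m ≃ fromℕ n → m ≡ n
fromℕ-injective m≃n = ℕ.≤-antisym (fromℕ-cancel (≃⇒≲ m≃n)) (fromℕ-cancel (≃⇒≲ (≃-sym m≃n)))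

fromℕ-+ : ∀ m n → fromℕ (m ℕ.+ n) ≃ fromℕ m +ᵣ fromℕ n
fromℕ-+ m n = pointwise λ _ → fromℕℚ-+ m n

seq-sumᵣ : ∀ {k} (f : Fin k → ℝ) n → seq (sumᵣ f) n ≡ sumℚ (λ i → seq (f i) n)
seq-sumᵣ {zero}  f n = refl
seq-sumᵣ {suc k} f n = cong (seq (f zero) n ℚ.+_) (seq-sumᵣ (λ i → f (suc i)) n)

sumᵣ-fromℕ : ∀ {n} (f : Fin n → ℕ) → sumᵣ (λ i → fromℕ (f i)) ≃ fromℕ (sumℕ f)
sumᵣ-fromℕ f = pointwise λ n → trans (seq-sumᵣ (λ i → fromℕ (f i)) n)
  (sym (sum-homo ℕ.+-0-monoid ℚ.+-0-monoid fromℕℚ refl fromℕℚ-+ f))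

-- Min-plus rank and tropical rank

transpose-left : ∀ {n} (i j : Fin n) → Components.transpose i j i ≡ j
transpose-left i j with i Fin.≟ i
... | yes _  = refl
... | no i≢i = contradiction refl i≢i

transpose-invariant : ∀ {A : Set} {n} (f : Fin n → A) {i j} → f i ≡ f j →
  ∀ k → f (Components.transpose i j k) ≡ f k
transpose-invariant f {i} {j} fi≡fj k with k Fin.≟ i
... | yes refl = sym fi≡fj
... | no _ with k Fin.≟ j
...   | yes refl = fi≡fj
...   | no _     = refl

-- A summand `⊤⁺` would make one of the two sums infinite, and it could not equal the real `ii` or
-- `jj`. Only finite summands remain, and they can be regrouped.
crossing : ∀ {ii jj ij ji} (a b c d : ℝ ⁺) → [ ii ] ≈⁺ (a +⁺ b) → [ jj ] ≈⁺ (c +⁺ d) →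
  [ ij ] ≤⁺ (a +⁺ d) → [ ji ] ≤⁺ (c +⁺ b) → ij +ᵣ ji ≲ ii +ᵣ jj
crossing {ii} {jj} {ij} {ji} [ a ] [ b ] [ c ] [ d ] [ ii≈ ] [ jj≈ ] [ ij≤ ] [ ji≤ ] = begin
  ij +ᵣ ji                 ≤⟨ +-mono-≲ {ij} {a +ᵣ d} {ji} {c +ᵣ b} ⟪ ij≤ ⟫ ⟪ ji≤ ⟫ ⟩
  (a +ᵣ d) +ᵣ (c +ᵣ b)     ≈⟨ pointwise (λ n → solve 4
                                (λ a b c d → (a :+ d) :+ (c :+ b) := (a :+ b) :+ (c :+ d))
                                refl (seq a n) (seq b n) (seq c n) (seq d n)) ⟩
  (a +ᵣ b) +ᵣ (c +ᵣ d)     ≈⟨ +-cong {ii} {a +ᵣ b} {jj} {c +ᵣ d} ⟪ ii≈ ⟫ ⟪ jj≈ ⟫ ⟨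
  ii +ᵣ jj                 ∎
  where open ≲-Reasoning

-- A term attaining the entries (i, i) and (j, j) also bounds (i, j) and (j, i).
separated≤minPlus : ∀ {X Y r k} (M : X → Y → ℝ) (row : Fin r → X) (col : Fin r → Y) →
  (∀ i j → M (row i) (col j) +ᵣ M (row j) (col i) ≲ M (row i) (col i) +ᵣ M (row j) (col j) → i ≡ j) →
  HasMinPlusFactorization M k → r ≤ k
separated≤minPlus {r = r} {k} M row col separated (u , v , isMin) = Fin.injective⇒≤ term-injective
  where
  term : Fin r → Fin k
  term i = proj₁ (proj₂ (isMin (row i) (col i)))
  attained : ∀ i → [ M (row i) (col i) ] ≈⁺ (u (term i) (row i) +⁺ v (term i) (col i))
  attained i = proj₂ (proj₂ (isMin (row i) (col i)))
  term-injective : Injective _≡_ _≡_ term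
  term-injective {i} {j} eq = separated i j
    (crossing (u (term i) (row i)) (v (term i) (col i)) (u (term i) (row j)) (v (term i) (col j))
      (attained i)
      (subst (λ t → [ M (row j) (col j) ] ≈⁺ (u t (row j) +⁺ v t (col j))) (sym eq) (attained j))
      (proj₁ (isMin (row i) (col j)) (term i))
      (proj₁ (isMin (row j) (col i)) (term i)))

isOptimal⇐ : ∀ {k} (N : Fin k → Fin k → ℕ) σ →
  (∀ τ → sumℕ (λ i → N i (σ ⟨$⟩ʳ i)) ≤ sumℕ (λ i → N i (τ ⟨$⟩ʳ i))) → IsOptimal (λ i j → fromℕ (N i j)) σ
isOptimal⇐ N σ h τ = _≲_.≤ (begin
  sumᵣ (λ i → fromℕ (N i (σ ⟨$⟩ʳ i))) ≈⟨ sumᵣ-fromℕ (λ i → N i (σ ⟨$⟩ʳ i)) ⟩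
  fromℕ (sumℕ (λ i → N i (σ ⟨$⟩ʳ i)))  ≤⟨ fromℕ-mono (h τ) ⟩
  fromℕ (sumℕ (λ i → N i (τ ⟨$⟩ʳ i)))  ≈⟨ sumᵣ-fromℕ (λ i → N i (τ ⟨$⟩ʳ i)) ⟨
  sumᵣ (λ i → fromℕ (N i (τ ⟨$⟩ʳ i))) ∎)
  where open ≲-Reasoning

isOptimal⇒ : ∀ {k} (N : Fin k → Fin k → ℕ) σ → IsOptimal (λ i j → fromℕ (N i j)) σ →
  ∀ τ → sumℕ (λ i → N i (σ ⟨$⟩ʳ i)) ≤ sumℕ (λ i → N i (τ ⟨$⟩ʳ i))
isOptimal⇒ N σ h τ = fromℕ-cancel (begin
  fromℕ (sumℕ (λ i → N i (σ ⟨$⟩ʳ i)))  ≈⟨ sumᵣ-fromℕ (λ i → N i (σ ⟨$⟩ʳ i)) ⟨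
  sumᵣ (λ i → fromℕ (N i (σ ⟨$⟩ʳ i))) ≤⟨ ⟪ h τ ⟫ ⟩
  sumᵣ (λ i → fromℕ (N i (τ ⟨$⟩ʳ i))) ≈⟨ sumᵣ-fromℕ (λ i → N i (τ ⟨$⟩ʳ i)) ⟩
  fromℕ (sumℕ (λ i → N i (τ ⟨$⟩ʳ i)))  ∎)
  where open ≲-Reasoning

fromℕ-+-cancel : ∀ m n p q → fromℕ m +ᵣ fromℕ n ≲ fromℕ p +ᵣ fromℕ q → m + n ≤ p + q
fromℕ-+-cancel m n p q h = fromℕ-cancel (≲-trans (≃⇒≲ (fromℕ-+ m n)) (≲-trans h (≃⇒≲ (≃-sym (fromℕ-+ p q)))))

module _ {X Y : Set} (W : X → Y → ℕ) where

  -- The certificate for all three upper bounds. Its natural values are at once min-plus vectors,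
  -- entries of an exchange argument and exponents of polynomials.
  record Factorization (r : ℕ) : Set where
    field
      u        : Fin r → X → ℕ
      v        : Fin r → Y → ℕ
      bound    : ∀ t x y → W x y ≤ u t x + v t y
      attained : ∀ x y → ∃[ t ] u t x + v t y ≤ W x y

  -- The certificate for all three lower bounds: the selected submatrix is zero exactly on its
  -- diagonal, and W, having natural values, is at least 1 on the rest of it.
  record FoolingSet (r : ℕ) : Set where
    field
      row         : Fin r → X
      col         : Fin r → Y
      diagonal    : ∀ i → W (row i) (col i) ≡ 0
      offDiagonal : ∀ i j → W (row i) (col j) ≡ 0 → i ≡ j

    row-injective : Injective _≡_ _≡_ row
    row-injective {i} {j} eq = offDiagonal i j (trans (cong (λ x → W x (col j)) eq) (diagonal j))

    col-injective : Injective _≡_ _≡_ col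
    col-injective {i} {j} eq = offDiagonal i j (trans (cong (W (row i)) (sym eq)) (diagonal i))

  hasMinPlusFactorization : ∀ {r} → Factorization r → HasMinPlusFactorization (λ x y → fromℕ (W x y)) r
  hasMinPlusFactorization F =
    (λ t x → [ fromℕ (u t x) ]) , (λ t y → [ fromℕ (v t y) ]) , λ x y →
      (λ t → [ _≲_.≤ (bound′ t x y) ]) ,
      let t , ≤W = attained x y
      in  t , [ _≃_.≈ (≲-antisym (bound′ t x y)
                (≲-trans (≃⇒≲ (≃-sym (fromℕ-+ (u t x) (v t y)))) (fromℕ-mono ≤W))) ]
    where
    open Factorization F
    bound′ : ∀ t x y → fromℕ (W x y) ≲ fromℕ (u t x) +ᵣ fromℕ (v t y)
    bound′ t x y = ≲-trans (fromℕ-mono (bound t x y)) (≃⇒≲ (fromℕ-+ (u t x) (v t y)))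

  fooling≤minPlus : ∀ {r k} → FoolingSet r → HasMinPlusFactorization (λ x y → fromℕ (W x y)) k → r ≤ k
  fooling≤minPlus {r} {k} S = separated≤minPlus (λ x y → fromℕ (W x y)) row col λ i j h →
    offDiagonal i j (ℕ.m+n≡0⇒m≡0 (W (row i) (col j)) (ℕ.n≤0⇒n≡0
      (subst (W (row i) (col j) + W (row j) (col i) ≤_) (cong₂ _+_ (diagonal i) (diagonal j))
        (fromℕ-+-cancel (W (row i) (col j)) (W (row j) (col i)) (W (row i) (col i)) (W (row j) (col j)) h))))
    where open FoolingSet S

  -- The identity costs 0, so an optimal permutation costs 0 as well. Then each entry that it
  -- selects is 0 and lies on the diagonal.
  foolingSet-nonsingular : ∀ {r} (S : FoolingSet r) →
    TropicallyNonsingular (λ i j → fromℕ (W (FoolingSet.row S i) (FoolingSet.col S j)))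
  foolingSet-nonsingular S = Permutation.id ,
    isOptimal⇐ N Permutation.id (λ τ → ℕ.≤-trans (ℕ.≤-reflexive diagonal-sum) z≤n) ,
    λ τ optimal i → sym (offDiagonal i _ (sum≡0⇒≡0 (λ i → N i (τ ⟨$⟩ʳ i))
      (ℕ.n≤0⇒n≡0 (ℕ.≤-trans (isOptimal⇒ N τ optimal Permutation.id) (ℕ.≤-reflexive diagonal-sum))) i))
    where
    open FoolingSet S
    N = λ i j → W (row i) (col j)
    diagonal-sum : sumℕ (λ i → N i i) ≡ 0
    diagonal-sum = ℕSum.sum-zero (λ i → N i i) diagonal

  -- If one term of the factorization serves two entries of an optimal
  -- permutation, exchanging these two gives another optimal permutation.
  nonsingular≤factorization : ∀ {r k} → Factorization r → (row : Fin k → X) (col : Fin k → Y) →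
    TropicallyNonsingular (λ i j → fromℕ (W (row i) (col j))) → k ≤ r
  nonsingular≤factorization {r} {k} F row col (σ , σ-optimal , unique) = ℕ.≮⇒≥ λ r<k →
    let i , j , i<j , eq = Fin.pigeonhole r<k term
        π = Permutation.transpose i j
        σj≡σi = trans (cong (σ ⟨$⟩ʳ_) (sym (transpose-left i j)))
                  (unique (π ∘ₚ σ) (exchange-optimal π (transpose-invariant term eq)) i)
    in  Fin.<⇒≢ i<j (sym (trans (sym (Permutation.inverseˡ σ)) (trans (cong (σ ⟨$⟩ˡ_) σj≡σi) (Permutation.inverseˡ σ))))
    where
    open Factorization F
    N = λ i j → W (row i) (col j)
    term : Fin k → Fin r
    term i = proj₁ (attained (row i) (col (σ ⟨$⟩ʳ i)))
    U V : Fin k → ℕ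
    U i = u (term i) (row i)
    V i = v (term i) (col (σ ⟨$⟩ʳ i))
    exchange-optimal : ∀ (π : Permutation′ k) →
      (∀ i → term (π ⟨$⟩ʳ i) ≡ term i) → IsOptimal (λ i j → fromℕ (W (row i) (col j))) (π ∘ₚ σ)
    exchange-optimal π same = isOptimal⇐ N (π ∘ₚ σ) λ τ → begin
      sumℕ (λ i → N i (σ ⟨$⟩ʳ (π ⟨$⟩ʳ i)))
        -- Rows `i` and `π i` share their term, so its value at row `i` plus its value at the column
        -- formerly assigned to `π i` bounds the exchanged entry. Summing over i only permutes the
        -- `V`.
        ≤⟨ sum-mono (λ i → subst (λ t → N i (σ ⟨$⟩ʳ (π ⟨$⟩ʳ i)) ≤ U i + v t (col (σ ⟨$⟩ʳ (π ⟨$⟩ʳ i))))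
             (sym (same i)) (bound (term i) (row i) (col (σ ⟨$⟩ʳ (π ⟨$⟩ʳ i))))) ⟩
      sumℕ (λ i → U i + V (π ⟨$⟩ʳ i))         ≡⟨ ∑ℕ-distrib-+ U (V ∘ (π ⟨$⟩ʳ_)) ⟩
      sumℕ U + sumℕ (V ∘ (π ⟨$⟩ʳ_))            ≡⟨ cong (sumℕ U +_) (sum-permute V π) ⟨
      sumℕ U + sumℕ V                          ≡⟨ ∑ℕ-distrib-+ U V ⟨
      sumℕ (λ i → U i + V i)                  ≤⟨ sum-mono (λ i → proj₂ (attained (row i) (col (σ ⟨$⟩ʳ i)))) ⟩
      sumℕ (λ i → N i (σ ⟨$⟩ʳ i))             ≤⟨ isOptimal⇒ N σ σ-optimal τ ⟩
      sumℕ (λ i → N i (τ ⟨$⟩ʳ i))             ∎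
      where open ℕ.≤-Reasoning

  minPlusRank : ∀ {r} → Factorization r → FoolingSet r → IsMinPlusRank (λ x y → fromℕ (W x y)) r
  minPlusRank F S = hasMinPlusFactorization F , λ k → fooling≤minPlus S

  tropicalRank : ∀ {r} → Factorization r → FoolingSet r → IsTropicalRank (λ x y → fromℕ (W x y)) r
  tropicalRank F S =
    (row , col , row-injective , col-injective , foolingSet-nonsingular S) ,
    λ { k (row′ , col′ , _ , _ , nonsingular) → nonsingular≤factorization F row′ col′ nonsingular }
    where open FoolingSet S

-- Complex numbers

infix 4 _≃ᶜ_

record _≃ᶜ_ (z w : ℂ) : Set where
  constructor ⟪_∥_⟫
  field
    re≃ : re z ≃ re w
    im≃ : im z ≃ im w

open _≃ᶜ_

≃ᶜ⇒≈ : ∀ {z w} → z ≃ᶜ w → z ≈ᶜ w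
≃ᶜ⇒≈ z≃w = _≃_.≈ (re≃ z≃w) , _≃_.≈ (im≃ z≃w)

≈⇒≃ᶜ : ∀ {z w} → z ≈ᶜ w → z ≃ᶜ w
≈⇒≃ᶜ (p , q) = ⟪ ⟪ p ⟫ ∥ ⟪ q ⟫ ⟫

≃ᶜ-refl : ∀ {z} → z ≃ᶜ z
≃ᶜ-refl {z} = ⟪ ≃-refl {re z} ∥ ≃-refl {im z} ⟫

≃ᶜ-sym : ∀ {z w} → z ≃ᶜ w → w ≃ᶜ z
≃ᶜ-sym ⟪ p ∥ q ⟫ = ⟪ ≃-sym p ∥ ≃-sym q ⟫

≃ᶜ-trans : ∀ {z w v} → z ≃ᶜ w → w ≃ᶜ v → z ≃ᶜ v
≃ᶜ-trans ⟪ p ∥ q ⟫ ⟪ p′ ∥ q′ ⟫ = ⟪ ≃-trans p p′ ∥ ≃-trans q q′ ⟫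

≡⇒≃ᶜ : ∀ {z w} → z ≡ w → z ≃ᶜ w
≡⇒≃ᶜ {z} refl = ≃ᶜ-refl {z}

+ᶜ-cong : ∀ z z′ w w′ → z ≃ᶜ z′ → w ≃ᶜ w′ → z +ᶜ w ≃ᶜ z′ +ᶜ w′
+ᶜ-cong (a +i b) (a′ +i b′) (c +i d) (c′ +i d′) ⟪ a≃ ∥ b≃ ⟫ ⟪ c≃ ∥ d≃ ⟫ =
  ⟪ +-cong {a} {a′} {c} {c′} a≃ c≃ ∥ +-cong {b} {b′} {d} {d′} b≃ d≃ ⟫

*ᶜ-cong : ∀ z z′ w w′ → z ≃ᶜ z′ → w ≃ᶜ w′ → z *ᶜ w ≃ᶜ z′ *ᶜ w′
*ᶜ-cong (a +i b) (a′ +i b′) (c +i d) (c′ +i d′) ⟪ a≃ ∥ b≃ ⟫ ⟪ c≃ ∥ d≃ ⟫ =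
  ⟪ +-cong {a *ᵣ c} {a′ *ᵣ c′} {(-ᵣ (b *ᵣ d))} {(-ᵣ (b′ *ᵣ d′))}
      (*-cong {a} {a′} {c} {c′} a≃ c≃)
      (-‿cong {b *ᵣ d} {b′ *ᵣ d′} (*-cong {b} {b′} {d} {d′} b≃ d≃))
  ∥ +-cong {a *ᵣ d} {a′ *ᵣ d′} {b *ᵣ c} {b′ *ᵣ c′}
      (*-cong {a} {a′} {d} {d′} a≃ d≃) (*-cong {b} {b′} {c} {c′} b≃ c≃) ⟫

0+z≃z : ∀ z → 0ᶜ +ᶜ z ≃ᶜ z
0+z≃z (a +i b) = ⟪ pointwise (λ n → ℚ.+-identityˡ (seq a n)) ∥ pointwise (λ n → ℚ.+-identityˡ (seq b n)) ⟫

z+0≃z : ∀ z → z +ᶜ 0ᶜ ≃ᶜ z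
z+0≃z (a +i b) = ⟪ pointwise (λ n → ℚ.+-identityʳ (seq a n)) ∥ pointwise (λ n → ℚ.+-identityʳ (seq b n)) ⟫

0*z≃0 : ∀ z → 0ᶜ *ᶜ z ≃ᶜ 0ᶜ
0*z≃0 (a +i b) =
  ⟪ pointwise (λ n → solve 2 (λ a b → con 0ℚ :* a :- con 0ℚ :* b := con 0ℚ) refl (seq a n) (seq b n))
  ∥ pointwise (λ n → solve 2 (λ a b → con 0ℚ :* b :+ con 0ℚ :* a := con 0ℚ) refl (seq a n) (seq b n)) ⟫

z*0≃0 : ∀ z → z *ᶜ 0ᶜ ≃ᶜ 0ᶜ
z*0≃0 (a +i b) =
  ⟪ pointwise (λ n → solve 2 (λ a b → a :* con 0ℚ :- b :* con 0ℚ := con 0ℚ) refl (seq a n) (seq b n))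
  ∥ pointwise (λ n → solve 2 (λ a b → a :* con 0ℚ :+ b :* con 0ℚ := con 0ℚ) refl (seq a n) (seq b n)) ⟫

z≃0⇒z*w≃0 : ∀ z w → z ≃ᶜ 0ᶜ → z *ᶜ w ≃ᶜ 0ᶜ
z≃0⇒z*w≃0 z w z≃0 = ≃ᶜ-trans (*ᶜ-cong z 0ᶜ w w z≃0 (≃ᶜ-refl {w})) (0*z≃0 w)

w≃0⇒z*w≃0 : ∀ z w → w ≃ᶜ 0ᶜ → z *ᶜ w ≃ᶜ 0ᶜ
w≃0⇒z*w≃0 z w w≃0 = ≃ᶜ-trans (*ᶜ-cong z z w 0ᶜ (≃ᶜ-refl {z}) w≃0) (z*0≃0 z)

fromℚᶜ : ℚ → ℂ
fromℚᶜ q = fromℚ q +i 0ᵣ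

fromℚᶜ-+ : ∀ p q → fromℚᶜ (p ℚ.+ q) ≃ᶜ fromℚᶜ p +ᶜ fromℚᶜ q
fromℚᶜ-+ p q = ⟪ pointwise (λ _ → refl) ∥ pointwise (λ _ → refl) ⟫

fromℚᶜ-* : ∀ p q → fromℚᶜ (p ℚ.* q) ≃ᶜ fromℚᶜ p *ᶜ fromℚᶜ q
fromℚᶜ-* p q =
  ⟪ pointwise (λ _ → solve 2 (λ p q → p :* q := p :* q :- con 0ℚ :* con 0ℚ) refl p q)
  ∥ pointwise (λ _ → solve 2 (λ p q → con 0ℚ := p :* con 0ℚ :+ con 0ℚ :* q) refl p q) ⟫

fromℚᶜ≃0⇒≡0 : ∀ {q} → fromℚᶜ q ≃ᶜ 0ᶜ → q ≡ 0ℚ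
fromℚᶜ≃0⇒≡0 {q} ⟪ q≃0 ∥ _ ⟫ = fromℚ-injective {q} {0ℚ} q≃0

+ᶜ-monoid : Monoid 0ℓ 0ℓ
+ᶜ-monoid = record
  { Carrier = ℂ ; _≈_ = _≃ᶜ_ ; _∙_ = _+ᶜ_ ; ε = 0ᶜ
  ; isMonoid = record
    { isSemigroup = record
      { isMagma = record
        { isEquivalence = record { refl = ≃ᶜ-refl ; sym = ≃ᶜ-sym ; trans = ≃ᶜ-trans }
        ; ∙-cong        = λ {z} {z′} {w} {w′} → +ᶜ-cong z z′ w w′ }
      ; assoc = λ { (a +i b) (c +i d) (e +i f) →
          ⟪ pointwise (λ n → ℚ.+-assoc (seq a n) (seq c n) (seq e n))
          ∥ pointwise (λ n → ℚ.+-assoc (seq b n) (seq d n) (seq f n)) ⟫ } }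
    ; identity = 0+z≃z , z+0≃z } }

module ℂSum = FiniteSum +ᶜ-monoid

fromℚᶜ-sum : ∀ {n} (f : Fin n → ℚ) → fromℚᶜ (sumℚ f) ≃ᶜ sumᶜ (λ i → fromℚᶜ (f i))
fromℚᶜ-sum = sum-homo ℚ.+-0-monoid +ᶜ-monoid fromℚᶜ (≃ᶜ-refl {0ᶜ}) fromℚᶜ-+

p*p≡∣p∣*∣p∣ : ∀ p → p ℚ.* p ≡ ℚ.∣ p ∣ ℚ.* ℚ.∣ p ∣
p*p≡∣p∣*∣p∣ p with ℚ.∣p∣≡p∨∣p∣≡-p p
... | inj₁ eq rewrite eq = refl
... | inj₂ eq rewrite eq = solve 1 (λ p → p :* p := (:- p) :* (:- p)) refl p

*-mono-≤-nonNeg : ∀ {p q r s} → 0ℚ ℚ.≤ p → 0ℚ ℚ.≤ s → p ℚ.≤ q → r ℚ.≤ s → p ℚ.* r ℚ.≤ q ℚ.* s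
*-mono-≤-nonNeg {p} {q} {r} {s} 0≤p 0≤s p≤q r≤s = ℚ.≤-trans
  (ℚ.*-monoˡ-≤-nonNeg p {{ℚ.nonNegative 0≤p}} r≤s) (ℚ.*-monoʳ-≤-nonNeg s {{ℚ.nonNegative 0≤s}} p≤q)

0≤p*p : ∀ p → 0ℚ ℚ.≤ p ℚ.* p
0≤p*p p = subst (0ℚ ℚ.≤_) (sym (p*p≡∣p∣*∣p∣ p))
  (ℚ.nonNegative⁻¹ _ {{ℚ.nonNeg*nonNeg⇒nonNeg ℚ.∣ p ∣ {{ℚ.∣-∣-nonNeg p}} ℚ.∣ p ∣ {{ℚ.∣-∣-nonNeg p}}}})

0<p*q : ∀ {p q} → 0ℚ ℚ.< p → 0ℚ ℚ.< q → 0ℚ ℚ.< p ℚ.* q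
0<p*q {p} {q} 0<p 0<q = ℚ.positive⁻¹ (p ℚ.* q) {{ℚ.pos*pos⇒pos p {{ℚ.positive 0<p}} q {{ℚ.positive 0<q}}}}

-- The hypothesis is used with tolerance ε², since p² + q² < ε² forces ∣p∣ < ε.
x²+y²≲0⇒x≃0 : ∀ x y → x *ᵣ x +ᵣ y *ᵣ y ≲ 0ᵣ → x ≃ 0ᵣ
x²+y²≲0⇒x≃0 x y ⟪ h ⟫ = ⟪ (λ ε 0<ε → eventually (λ {n} → small (seq x n) (seq y n) 0<ε) (h (ε ℚ.* ε) (0<p*q 0<ε 0<ε))) ⟫
  where
  small : ∀ p q {ε} → 0ℚ ℚ.< ε → p ℚ.* p ℚ.+ q ℚ.* q ℚ.< 0ℚ ℚ.+ ε ℚ.* ε → ℚ.∣ p ℚ.- 0ℚ ∣ ℚ.< ε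
  small p q {ε} 0<ε h = subst (ℚ._< ε) (sym (∣p-0∣≡∣p∣ p)) (ℚ.≰⇒> λ ε≤∣p∣ → ℚ<⇒≱ h (begin
    0ℚ ℚ.+ ε ℚ.* ε            ≡⟨ ℚ.+-identityˡ (ε ℚ.* ε) ⟩
    ε ℚ.* ε                   ≤⟨ *-mono-≤-nonNeg (ℚ.<⇒≤ 0<ε) (ℚ.0≤∣p∣ p) ε≤∣p∣ ε≤∣p∣ ⟩
    ℚ.∣ p ∣ ℚ.* ℚ.∣ p ∣       ≡⟨ p*p≡∣p∣*∣p∣ p ⟨
    p ℚ.* p                   ≡⟨ ℚ.+-identityʳ (p ℚ.* p) ⟨
    p ℚ.* p ℚ.+ 0ℚ            ≤⟨ ℚ.+-monoʳ-≤ (p ℚ.* p) (0≤p*p q) ⟩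
    p ℚ.* p ℚ.+ q ℚ.* q       ∎))
    where open ℚ.≤-Reasoning

-- Eventually x exceeds a fixed rational η > 0; a product smaller than η ε then forces ∣y∣ < ε.
0<x⇒xy≃0⇒y≃0 : ∀ x y → 0ᵣ <ᵣ x → x *ᵣ y ≃ 0ᵣ → y ≃ 0ᵣ
0<x⇒xy≃0⇒y≃0 x y (η , 0<η , η<x) ⟪ xy≈0 ⟫ = ⟪ (λ ε 0<ε → eventually₂
  (λ {n} → small (seq x n) (seq y n) 0<ε) η<x (xy≈0 (η ℚ.* ε) (0<p*q 0<η 0<ε))) ⟫
  where
  small : ∀ p q {ε} → 0ℚ ℚ.< ε → 0ℚ ℚ.+ η ℚ.< p → ℚ.∣ p ℚ.* q ℚ.- 0ℚ ∣ ℚ.< η ℚ.* ε → ℚ.∣ q ℚ.- 0ℚ ∣ ℚ.< ε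
  small p q {ε} 0<ε η<p h = subst (ℚ._< ε) (sym (∣p-0∣≡∣p∣ q)) (ℚ.≰⇒> λ ε≤∣q∣ →
    ℚ<⇒≱ h (begin
      η ℚ.* ε                   ≤⟨ *-mono-≤-nonNeg (ℚ.<⇒≤ 0<η) (ℚ.0≤∣p∣ q)
                                     (ℚ.≤-trans (ℚ.≤-trans (ℚ.≤-reflexive (sym (ℚ.+-identityˡ η))) (ℚ.<⇒≤ η<p)) (p≤∣p∣ p)) ε≤∣q∣ ⟩
      ℚ.∣ p ∣ ℚ.* ℚ.∣ q ∣       ≡⟨ ℚ.∣p*q∣≡∣p∣*∣q∣ p q ⟨
      ℚ.∣ p ℚ.* q ∣             ≡⟨ ∣p-0∣≡∣p∣ (p ℚ.* q) ⟨
      ℚ.∣ p ℚ.* q ℚ.- 0ℚ ∣      ∎))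
    where open ℚ.≤-Reasoning

-- Zero divisors and least exponents under excluded middle

module Classical (em : ExcludedMiddle 0ℓ) where

  -- Multiplying z w = 0 by the conjugate of z gives ∣z∣² w = 0.
  zw≃0⇒z≃0∨w≃0 : ∀ z w → z *ᶜ w ≃ᶜ 0ᶜ → z ≃ᶜ 0ᶜ ⊎ w ≃ᶜ 0ᶜ
  zw≃0⇒z≃0∨w≃0 (a +i b) (c +i d) ⟪ e≃0 ∥ f≃0 ⟫ = case em {0ᵣ <ᵣ a *ᵣ a +ᵣ b *ᵣ b} of λ
    { (yes 0<N) → inj₂
        ⟪ 0<x⇒xy≃0⇒y≃0 (a *ᵣ a +ᵣ b *ᵣ b) c 0<N (≃-trans
            (pointwise λ n → solve 4 (λ a b c d → (a :* a :+ b :* b) :* c :=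
              (a :* c :- b :* d) :* a :+ (a :* d :+ b :* c) :* b) refl (seq a n) (seq b n) (seq c n) (seq d n))
            (≃-trans (+-cong {(a *ᵣ c -ᵣ b *ᵣ d) *ᵣ a} {0ᵣ} {(a *ᵣ d +ᵣ b *ᵣ c) *ᵣ b} {0ᵣ}
                (x≃0⇒xy≃0 {a *ᵣ c -ᵣ b *ᵣ d} a e≃0) (x≃0⇒xy≃0 {a *ᵣ d +ᵣ b *ᵣ c} b f≃0))
              (pointwise λ _ → refl)))
        ∥ 0<x⇒xy≃0⇒y≃0 (a *ᵣ a +ᵣ b *ᵣ b) d 0<N (≃-trans
            (pointwise λ n → solve 4 (λ a b c d → (a :* a :+ b :* b) :* d :=
              (a :* d :+ b :* c) :* a :+ (a :* c :- b :* d) :* (:- b)) refl (seq a n) (seq b n) (seq c n) (seq d n))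
            (≃-trans (+-cong {(a *ᵣ d +ᵣ b *ᵣ c) *ᵣ a} {0ᵣ} {(a *ᵣ c -ᵣ b *ᵣ d) *ᵣ (-ᵣ b)} {0ᵣ}
                (x≃0⇒xy≃0 {a *ᵣ d +ᵣ b *ᵣ c} a f≃0) (x≃0⇒xy≃0 {a *ᵣ c -ᵣ b *ᵣ d} (-ᵣ b) e≃0))
              (pointwise λ _ → refl))) ⟫
    ; (no N≤0) → inj₁
        ⟪ x²+y²≲0⇒x≃0 a b (≮⇒≳ N≤0)
        ∥ x²+y²≲0⇒x≃0 b a (≲-trans {y = a *ᵣ a +ᵣ b *ᵣ b}
            (≃⇒≲ (pointwise λ n → ℚ.+-comm (seq b n ℚ.* seq b n) (seq a n ℚ.* seq a n))) (≮⇒≳ N≤0)) ⟫ }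

  vanishes : ∀ {z} → ¬ (z ≉ᶜ 0ᶜ) → z ≃ᶜ 0ᶜ
  vanishes h = ≈⇒≃ᶜ (decidable-stable em h)

  -- Descent along the well-founded support: excluded middle says at each exponent whether a smaller
  -- one is left.
  minimalExponent : ∀ (f : K) γ → InSupport (coeff f) γ →
    ∃[ γ₀ ] InSupport (coeff f) γ₀ × (∀ δ → InSupport (coeff f) δ → γ₀ ≲ δ)
  minimalExponent f γ γ∈ = go (γ , γ∈) (wellOrdered f (γ , γ∈))
    where
    go : ∀ γ → Acc (_<ᵣ_ on proj₁) γ → _
    go (γ , γ∈) (acc rec) = case em {∃[ δ ] InSupport (coeff f) δ × δ <ᵣ γ} of λ
      { (yes (δ , δ∈ , δ<γ)) → go (δ , δ∈) (rec δ<γ)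
      ; (no none)            → γ , γ∈ , λ δ δ∈ → ≮⇒≳ λ δ<γ → none (δ , δ∈ , δ<γ) }

  -- Other entries may share the exponent `γ`. Such ties do no harm later: in row j of a fooling set
  -- the other columns have positive valuation and contribute nothing at `γ`.
  MinimalEntry : ∀ {k} → (Fin k → K) → Set
  MinimalEntry c = ∃₂ λ j γ → InSupport (coeff (c j)) γ × (∀ i δ → InSupport (coeff (c i)) δ → γ ≲ δ)

  zeroOrMinimalEntry : ∀ {k} (c : Fin k → K) → (∀ j → IsZero (c j)) ⊎ MinimalEntry c
  zeroOrMinimalEntry {zero}  c = inj₁ λ ()
  zeroOrMinimalEntry {suc k} c = case em {∃ (InSupport (coeff (c zero)))} of λ
    { (no none) →
        let zero∉ = λ γ γ∈ → none (γ , γ∈)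
        in  case zeroOrMinimalEntry (λ j → c (suc j)) of λ
              { (inj₁ zeros) → inj₁ λ { zero γ → decidable-stable em (zero∉ γ) ; (suc j) → zeros j }
              ; (inj₂ (j , γ , γ∈ , least)) → inj₂ (suc j , γ , γ∈ ,
                  λ { zero δ δ∈ → contradiction δ∈ (zero∉ δ) ; (suc i) → least i }) }
    ; (yes (γ , γ∈)) →
        let γ₀ , γ₀∈ , least₀ = minimalExponent (c zero) γ γ∈
        in  case zeroOrMinimalEntry (λ j → c (suc j)) of λ
              { (inj₁ zeros) → inj₂ (zero , γ₀ , γ₀∈ ,
                  λ { zero → least₀ ; (suc i) δ δ∈ → contradiction (zeros i δ) δ∈ })
              ; (inj₂ (j , γ₁ , γ₁∈ , least₁)) → case em {γ₁ <ᵣ γ₀} of λ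
                  { (yes γ₁<γ₀) → inj₂ (suc j , γ₁ , γ₁∈ ,
                      λ { zero δ δ∈ → ≲-trans (<⇒≲ γ₁<γ₀) (least₀ δ δ∈) ; (suc i) → least₁ i })
                  ; (no γ₁≮γ₀) → inj₂ (zero , γ₀ , γ₀∈ ,
                      λ { zero → least₀ ; (suc i) δ δ∈ → ≲-trans (≮⇒≳ γ₁≮γ₀) (least₁ i δ δ∈) }) } } }

-- Generalized power series

x≲y-z⇒x+z≲y : ∀ x y z → x ≲ y -ᵣ z → x +ᵣ z ≲ y
x≲y-z⇒x+z≲y x y z h = ≲-trans {y = (y -ᵣ z) +ᵣ z}
  (+-mono-≲ {x} {y -ᵣ z} {z} {z} h (≃⇒≲ (≃-refl {z})))
  (≃⇒≲ (pointwise λ n → solve 2 (λ y z → (y :- z) :+ z := y) refl (seq y n) (seq z n)))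

-- For a product c · A with A of valuation w: a contribution at `γ` pairs an exponent `α` of c with
-- γ - α ≥ w ≥ 0. When `γ` is also a lower bound for the exponents of c, this leaves α = γ, and the
-- next lemma gives w = 0.
complement-≲ : ∀ w α γ → fromℕ w ≲ γ -ᵣ α → α ≲ γ
complement-≲ w α γ h = ≲-trans {y = fromℕ w +ᵣ α}
  (≲-trans {y = fromℕ 0 +ᵣ α} (≃⇒≲ (pointwise λ n → sym (ℚ.+-identityˡ (seq α n))))
    (+-mono-≲ {fromℕ 0} {fromℕ w} {α} {α} (fromℕ-mono {0} {w} ℕ.z≤n) (≃⇒≲ (≃-refl {α}))))
  (x≲y-z⇒x+z≲y (fromℕ w) γ α h)

complement-≡0 : ∀ w α γ → fromℕ w ≲ γ -ᵣ α → γ ≲ α → w ≡ 0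
complement-≡0 w α γ h γ≲α = ℕ.n≤0⇒n≡0 (fromℕ-cancel {w} {0} (≲-trans {y = γ -ᵣ α} h
  (≲-trans {y = α -ᵣ α} (+-mono-≲ {γ} {α} { -ᵣ α} { -ᵣ α} γ≲α (≃⇒≲ (≃-refl { -ᵣ α})))
    (≃⇒≲ (pointwise λ n → ℚ.+-inverseʳ (seq α n))))))

-ᵣ-congˡ : ∀ γ {α β} → α ≃ β → γ -ᵣ α ≃ γ -ᵣ β
-ᵣ-congˡ γ {α} {β} α≃β = +-cong {γ} {γ} { -ᵣ α} { -ᵣ β} (≃-refl {γ}) (-‿cong α≃β)

coeff-cong′ : ∀ f {γ δ} → γ ≃ δ → coeff f γ ≃ᶜ coeff f δ
coeff-cong′ f ⟪ γ≈δ ⟫ = ≈⇒≃ᶜ (coeff-cong f γ≈δ)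

module Products (em : ExcludedMiddle 0ℓ) where
  open Classical em

  term-vanishes : ∀ f g γ α → ¬ (InSupport (coeff f) α × InSupport (coeff g) (γ -ᵣ α)) → coeff f α *ᶜ coeff g (γ -ᵣ α) ≃ᶜ 0ᶜ
  term-vanishes f g γ α h = case em {InSupport (coeff f) α} of λ
    { (no α∉)  → z≃0⇒z*w≃0 (coeff f α) (coeff g (γ -ᵣ α)) (vanishes α∉)
    ; (yes α∈) → w≃0⇒z*w≃0 (coeff f α) (coeff g (γ -ᵣ α)) (vanishes λ β∈ → h (α∈ , β∈)) }

  product-coeff : ∀ {f g h} → IsProduct f g h → ∀ γ → Σ[ αs ∈ List ℝ ] Uniqueᵣ αs
    × (∀ α → InSupport (coeff f) α → InSupport (coeff g) (γ -ᵣ α) → α ∈ᵣ αs)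
    × coeff h γ ≃ᶜ ℂSum.listSum (λ α → coeff f α *ᶜ coeff g (γ -ᵣ α)) αs
  product-coeff {f} {g} {h} prod γ = let αs , unique , covers , h≈ = prod γ in
    αs , unique , covers ,
    ≈⇒≃ᶜ {coeff h γ} {List.foldr _+ᶜ_ 0ᶜ (List.map (λ α → coeff f α *ᶜ coeff g (γ -ᵣ α)) αs)} h≈

  product-vanishes : ∀ {f g h} → IsProduct f g h → ∀ γ →
    (∀ α → ¬ (InSupport (coeff f) α × InSupport (coeff g) (γ -ᵣ α))) → coeff h γ ≃ᶜ 0ᶜ
  product-vanishes {f} {g} {h} prod γ none =
    let αs , _ , _ , h≃ = product-coeff {f} {g} {h} prod γ
    in  ≃ᶜ-trans h≃ (ℂSum.listSum-zero (λ α → coeff f α *ᶜ coeff g (γ -ᵣ α))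
          (ListAll.universal (λ α → term-vanishes f g γ α (none α)) αs))

  -- The list provided by `IsProduct` is arbitrary, but it contains `α` once up to equality, and its
  -- other terms vanish by uniqueness.
  product-leading : ∀ {f g h} → IsProduct f g h → ∀ γ α → InSupport (coeff f) α → InSupport (coeff g) (γ -ᵣ α) →
    (∀ β → InSupport (coeff f) β → InSupport (coeff g) (γ -ᵣ β) → α ≃ β) →
    coeff h γ ≃ᶜ coeff f α *ᶜ coeff g (γ -ᵣ α)
  product-leading {f} {g} {h} prod γ α α∈ γ-α∈ only =
    let αs , unique , covers , h≃ = product-coeff {f} {g} {h} prod γ
    in  ≃ᶜ-trans h≃ (ℂSum.listSum-single ℝ-setoid (λ α → coeff f α *ᶜ coeff g (γ -ᵣ α)) α
          (λ {β} α≈β → near β (≃-sym (⟪_⟫ {α} {β} α≈β)))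
          (λ {β} α≉β → term-vanishes f g γ β λ (β∈ , γ-β∈) → α≉β (_≃_.≈ (only β β∈ γ-β∈)))
          unique (covers α α∈ γ-α∈))
    where
    near : ∀ β → β ≃ α → coeff f β *ᶜ coeff g (γ -ᵣ β) ≃ᶜ coeff f α *ᶜ coeff g (γ -ᵣ α)
    near β β≃α = *ᶜ-cong (coeff f β) (coeff f α) (coeff g (γ -ᵣ β)) (coeff g (γ -ᵣ α))
      (coeff-cong′ f β≃α) (coeff-cong′ g {γ -ᵣ β} {γ -ᵣ α} (-ᵣ-congˡ γ {β} {α} β≃α))

  product-≉0 : ∀ z w → z ≉ᶜ 0ᶜ → w ≉ᶜ 0ᶜ → ¬ (z *ᶜ w ≃ᶜ 0ᶜ)
  product-≉0 z w z≉0 w≉0 zw≃0 = case zw≃0⇒z≃0∨w≃0 z w zw≃0 of λ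
    { (inj₁ z≃0) → z≉0 (≃ᶜ⇒≈ z≃0)
    ; (inj₂ w≃0) → w≉0 (≃ᶜ⇒≈ w≃0) }

  -- If c_j has the least exponent γ of all the c_i, then row j of Σ_i c_i A_i
  -- has a nonzero coefficient at γ.
  separated-independent : ∀ {X Y : Set} {r} (W : X → Y → ℕ) (row : Fin r → X) (col : Fin r → Y) →
    (∀ i → W (row i) (col i) ≡ 0) → (∀ i j → W (row i) (col j) ≡ 0 → i ≡ j) →
    (A : X → Y → K) → IsLift (λ x y → fromℕ (W x y)) A → IsIndependent (λ x j → A x (col j))
  separated-independent W row col diagonal offDiagonal A lift c p prod sum≈0 = case zeroOrMinimalEntry c of λ
    { (inj₁ zeros)                 → zeros
    ; (inj₂ (j , γ , γ∈ , least)) → contradiction (trans′ (leading j γ γ∈ (least j)) (row-vanishes j γ least))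
        (product-≉0 (coeff (c j) γ) (coeff (A (row j) (col j)) (γ -ᵣ γ)) γ∈ (γ-γ∈ j γ)) }
    where
    trans′ : ∀ {z w} → z ≃ᶜ w → z ≃ᶜ 0ᶜ → w ≃ᶜ 0ᶜ
    trans′ z≃w z≃0 = ≃ᶜ-trans (≃ᶜ-sym z≃w) z≃0

    complement∈ : ∀ j i γ α → InSupport (coeff (A (row j) (col i))) (γ -ᵣ α) → fromℕ (W (row j) (col i)) ≲ γ -ᵣ α
    complement∈ j i γ α α∈ = ⟪_⟫ {fromℕ (W (row j) (col i))} {γ -ᵣ α} (proj₂ (proj₂ (lift (row j) (col i))) (γ -ᵣ α) α∈)

    -- Diagonal entries have valuation 0. The exponent takes the form `γ -ᵣ γ` because the
    -- coefficient of a product asks for it so.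
    γ-γ∈ : ∀ j γ → InSupport (coeff (A (row j) (col j))) (γ -ᵣ γ)
    γ-γ∈ j γ h = proj₁ (proj₂ (lift (row j) (col j))) (≃ᶜ⇒≈ {coeff (A (row j) (col j)) (fromℕ (W (row j) (col j)))} {0ᶜ} (≃ᶜ-trans
      (coeff-cong′ (A (row j) (col j)) {fromℕ (W (row j) (col j))} {γ -ᵣ γ}
        (pointwise λ n → trans (cong fromℕℚ (diagonal j)) (sym (ℚ.+-inverseʳ (seq γ n)))))
      (≈⇒≃ᶜ {coeff (A (row j) (col j)) (γ -ᵣ γ)} {0ᶜ} h)))

    leading : ∀ j γ → InSupport (coeff (c j)) γ → (∀ δ → InSupport (coeff (c j)) δ → γ ≲ δ) →
      coeff (p (row j) j) γ ≃ᶜ coeff (c j) γ *ᶜ coeff (A (row j) (col j)) (γ -ᵣ γ)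
    leading j γ γ∈ least = product-leading {c j} {A (row j) (col j)} {p (row j) j} (prod (row j) j) γ γ γ∈ (γ-γ∈ j γ)
      λ β β∈ γ-β∈ → ≲-antisym (least β β∈) (complement-≲ (W (row j) (col j)) β γ (complement∈ j j γ β γ-β∈))

    others : ∀ j γ → (∀ i δ → InSupport (coeff (c i)) δ → γ ≲ δ) →
      ∀ i → i ≢ j → coeff (p (row j) i) γ ≃ᶜ 0ᶜ
    others j γ least i i≢j = product-vanishes {c i} {A (row j) (col i)} {p (row j) i} (prod (row j) i) γ
      λ α (α∈ , γ-α∈) → i≢j (sym (offDiagonal j i
        (complement-≡0 (W (row j) (col i)) α γ (complement∈ j i γ α γ-α∈) (least i α α∈))))

    row-vanishes : ∀ j γ → (∀ i δ → InSupport (coeff (c i)) δ → γ ≲ δ) → coeff (p (row j) j) γ ≃ᶜ 0ᶜ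
    row-vanishes j γ least = ≃ᶜ-trans
      (≃ᶜ-sym (ℂSum.sum-single (λ i → coeff (p (row j) i) γ) j (others j γ least)))
      (≈⇒≃ᶜ {sumᶜ (λ i → coeff (p (row j) i) γ)} {0ᶜ} (sum≈0 (row j) γ))

-- Linear systems and power series over ℚ

insert : ∀ {k} → Fin (suc k) → (Fin k → ℚ) → ℚ → Fin (suc k) → ℚ
insert p z a = Vector.insertAt z p a

sum-insert : ∀ {k} p (z : Fin k → ℚ) a (f : Fin (suc k) → ℚ) →
  sumℚ (λ j → f j ℚ.* insert p z a j) ≡ f p ℚ.* a ℚ.+ sumℚ (λ j → f (punchIn p j) ℚ.* z j)
sum-insert p z a f = trans (sum-remove {i = p} (λ j → f j ℚ.* insert p z a j))
  (cong₂ ℚ._+_ (cong (f p ℚ.*_) (Vector.insertAt-lookup z p a))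
    (sum-cong-≗ λ j → cong (f (punchIn p j) ℚ.*_) (Vector.insertAt-punchIn z p a j)))

sum-linear : ∀ {k} s (f g z : Fin k → ℚ) →
  sumℚ (λ j → (f j ℚ.- s ℚ.* g j) ℚ.* z j) ≡ sumℚ (λ j → f j ℚ.* z j) ℚ.- s ℚ.* sumℚ (λ j → g j ℚ.* z j)
sum-linear s f g z = begin
  sumℚ (λ j → (f j ℚ.- s ℚ.* g j) ℚ.* z j)
    ≡⟨ sum-cong-≗ (λ j → solve 4 (λ f s g z → (f :- s :* g) :* z := f :* z :+ (:- s) :* (g :* z)) refl (f j) s (g j) (z j)) ⟩
  sumℚ (λ j → f j ℚ.* z j ℚ.+ (ℚ.- s) ℚ.* (g j ℚ.* z j))
    ≡⟨ ∑ℚ-distrib-+ (λ j → f j ℚ.* z j) (λ j → (ℚ.- s) ℚ.* (g j ℚ.* z j)) ⟩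
  sumℚ (λ j → f j ℚ.* z j) ℚ.+ sumℚ (λ j → (ℚ.- s) ℚ.* (g j ℚ.* z j))
    ≡⟨ cong (sumℚ (λ j → f j ℚ.* z j) ℚ.+_) (*-distribˡ-sum (ℚ.- s) (λ j → g j ℚ.* z j)) ⟨
  sumℚ (λ j → f j ℚ.* z j) ℚ.+ (ℚ.- s) ℚ.* sumℚ (λ j → g j ℚ.* z j)
    ≡⟨ cong (sumℚ (λ j → f j ℚ.* z j) ℚ.+_) (ℚ.neg-distribˡ-* s (sumℚ (λ j → g j ℚ.* z j))) ⟨
  sumℚ (λ j → f j ℚ.* z j) ℚ.- s ℚ.* sumℚ (λ j → g j ℚ.* z j) ∎
  where open ≡-Reasoning

-- Gaussian elimination, one equation at a time. A zero first row imposes no condition; otherwise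
-- its pivot column `p` is cleared from the other rows, the smaller system is solved and the unknown
-- at `p` is put back.
nontrivialKernel : ∀ {r k} → r ℕ.< k → (M : Fin r → Fin k → ℚ) →
  Σ[ z ∈ (Fin k → ℚ) ] (∃[ j ] z j ≢ 0ℚ) × (∀ i → sumℚ (λ j → M i j ℚ.* z j) ≡ 0ℚ)
nontrivialKernel {zero}  {suc k} _ M = (λ _ → 1ℚ) , (zero , ℚ.1≢0) , λ ()
nontrivialKernel {suc r} {suc k} (ℕ.s≤s r<k) M with Fin.any? (λ j → ¬? (M zero j ℚ.≟ 0ℚ))
... | no ¬pivot =
  let z , nonzero , kernel = nontrivialKernel (ℕ.m<n⇒m<1+n r<k) (M ∘ suc)
  in  z , nonzero , λ
    { zero    → ℚSum.sum-zero _ λ j → trans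
        (cong (ℚ._* z j) (decidable-stable (M zero j ℚ.≟ 0ℚ) λ M≢0 → ¬pivot (j , M≢0))) (ℚ.*-zeroˡ (z j))
    ; (suc i) → kernel i }
... | yes (p , pivot≢0) =
  let z , (j , z≢0) , kernel = nontrivialKernel r<k λ i j → M (suc i) (punchIn p j) ℚ.- factor i ℚ.* M zero (punchIn p j)
      S = sumℚ (λ j → M zero (punchIn p j) ℚ.* z j)
  -- With `w` the reciprocal of the pivot, this value of the unknown at `p` is what the first
  -- equation demands.
  in  insert p z (ℚ.- (w ℚ.* S)) , (punchIn p j , z≢0 ∘ trans (sym (Vector.insertAt-punchIn z p _ j))) , λ
    { zero    → trans (sum-insert p z _ (M zero)) (begin
        M zero p ℚ.* (ℚ.- (w ℚ.* S)) ℚ.+ S  ≡⟨ solve 3 (λ m w s → m :* (:- (w :* s)) :+ s := (con 1ℚ :- m :* w) :* s) refl (M zero p) w S ⟩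
        (1ℚ ℚ.- M zero p ℚ.* w) ℚ.* S       ≡⟨ cong (λ e → (1ℚ ℚ.- e) ℚ.* S) (ℚ.*-inverseʳ (M zero p)) ⟩
        0ℚ ℚ.* S                            ≡⟨ ℚ.*-zeroˡ S ⟩
        0ℚ                                  ∎)
    ; (suc i) → trans (sum-insert p z _ (M (suc i))) (begin
        M (suc i) p ℚ.* (ℚ.- (w ℚ.* S)) ℚ.+ sumℚ (λ j → M (suc i) (punchIn p j) ℚ.* z j)
          ≡⟨ solve 4 (λ m w s t → m :* (:- (w :* s)) :+ t := t :- (m :* w) :* s) refl (M (suc i) p) w S (sumℚ (λ j → M (suc i) (punchIn p j) ℚ.* z j)) ⟩
        sumℚ (λ j → M (suc i) (punchIn p j) ℚ.* z j) ℚ.- factor i ℚ.* S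
          ≡⟨ sum-linear (factor i) (M (suc i) ∘ punchIn p) (M zero ∘ punchIn p) z ⟨
        sumℚ (λ j → (M (suc i) (punchIn p j) ℚ.- factor i ℚ.* M zero (punchIn p j)) ℚ.* z j)
          ≡⟨ kernel i ⟩
        0ℚ ∎) }
  where
  open ≡-Reasoning
  instance _ = ℚ.≢-nonZero pivot≢0
  w = ℚ.1/ M zero p
  factor : Fin r → ℚ
  factor i = M (suc i) p ℚ.* w

Sequence : Set
Sequence = ℕ → ℚ

-- Sequences are the coefficients of power series; this is multiplication by z^a.
shift : ℕ → Sequence → Sequence
shift zero    f n       = f n
shift (suc a) f zero    = 0ℚ
shift (suc a) f (suc n) = shift a f n

monomial : ℕ → Sequence
monomial zero    zero    = 1ℚ
monomial zero    (suc n) = 0ℚ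
monomial (suc a) zero    = 0ℚ
monomial (suc a) (suc n) = monomial a n

-- The Cauchy product, peeling the constant term off `f`. The same recursion enumerates the
-- exponents 0, ..., n in `listSum-convolution`.
convolution : Sequence → Sequence → Sequence
convolution f g zero    = f 0 ℚ.* g 0
convolution f g (suc n) = f 0 ℚ.* g (suc n) ℚ.+ convolution (f ∘ suc) g n

shift-∘ : ∀ a b f n → shift (a ℕ.+ b) f n ≡ shift a (shift b f) n
shift-∘ zero    b f n       = refl
shift-∘ (suc a) b f zero    = refl
shift-∘ (suc a) b f (suc n) = shift-∘ a b f n

shift-cong : ∀ a {f g : Sequence} → (∀ n → f n ≡ g n) → ∀ n → shift a f n ≡ shift a g n
shift-cong zero    f≗g n       = f≗g n
shift-cong (suc a) f≗g zero    = refl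
shift-cong (suc a) f≗g (suc n) = shift-cong a f≗g n

shift-zero : ∀ a n → shift a (λ _ → 0ℚ) n ≡ 0ℚ
shift-zero zero    n       = refl
shift-zero (suc a) zero    = refl
shift-zero (suc a) (suc n) = shift-zero a n

shift-sum : ∀ a {k} (f : Fin k → Sequence) n → shift a (λ n → sumℚ (λ j → f j n)) n ≡ sumℚ (λ j → shift a (f j) n)
shift-sum zero    f n           = refl
shift-sum (suc a) {k} f zero    = sym (ℚSum.sum-zero {k} (λ _ → 0ℚ) λ _ → refl)
shift-sum (suc a) f (suc n)     = shift-sum a f n

shift-* : ∀ a s f n → shift a (λ n → s ℚ.* f n) n ≡ s ℚ.* shift a f n
shift-* zero    s f n       = refl
shift-* (suc a) s f zero    = sym (ℚ.*-zeroʳ s)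
shift-* (suc a) s f (suc n) = shift-* a s f n

shift-monomial : ∀ a b n → shift a (monomial b) n ≡ monomial (a ℕ.+ b) n
shift-monomial zero    b n       = refl
shift-monomial (suc a) b zero    = refl
shift-monomial (suc a) b (suc n) = shift-monomial a b n

monomial-diagonal : ∀ a → monomial a a ≡ 1ℚ
monomial-diagonal zero    = refl
monomial-diagonal (suc a) = monomial-diagonal a

monomial-offDiagonal : ∀ {a n} → a ≢ n → monomial a n ≡ 0ℚ
monomial-offDiagonal {zero}  {zero}  a≢n = contradiction refl a≢n
monomial-offDiagonal {zero}  {suc n} a≢n = refl
monomial-offDiagonal {suc a} {zero}  a≢n = refl
monomial-offDiagonal {suc a} {suc n} a≢n = monomial-offDiagonal (a≢n ∘ cong suc)

monomial-nonNeg : ∀ a n → 0ℚ ℚ.≤ monomial a n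
monomial-nonNeg zero    zero    = ℚ.<⇒≤ (ℚ.positive⁻¹ 1ℚ)
monomial-nonNeg zero    (suc n) = ℚ.≤-refl
monomial-nonNeg (suc a) zero    = ℚ.≤-refl
monomial-nonNeg (suc a) (suc n) = monomial-nonNeg a n

convolution-monomial : ∀ f a n → convolution f (monomial a) n ≡ shift a f n
convolution-monomial f zero    zero    = ℚ.*-identityʳ (f 0)
convolution-monomial f (suc a) zero    = ℚ.*-zeroʳ (f 0)
convolution-monomial f zero    (suc n) = trans (cong₂ ℚ._+_ (ℚ.*-zeroʳ (f 0)) (convolution-monomial (f ∘ suc) zero n))
  (ℚ.+-identityˡ (f (suc n)))
convolution-monomial f (suc a) (suc n) =
  trans (cong (f 0 ℚ.* monomial a n ℚ.+_) (convolution-monomial (f ∘ suc) (suc a) n)) (sym (unshift a n))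
  where
  -- The identity z^a f = f(0) z^a + z^(a+1) g, where f = f(0) + z g.
  unshift : ∀ a n → shift a f n ≡ f 0 ℚ.* monomial a n ℚ.+ shift (suc a) (f ∘ suc) n
  unshift zero    zero    = solve 1 (λ x → x := x :* con 1ℚ :+ con 0ℚ) refl (f 0)
  unshift (suc a) zero    = solve 1 (λ x → con 0ℚ := x :* con 0ℚ :+ con 0ℚ) refl (f 0)
  unshift zero    (suc n) = solve 2 (λ x y → y := x :* con 0ℚ :+ y) refl (f 0) (f (suc n))
  unshift (suc a) (suc n) = unshift a n

convolution-sum : ∀ f {k} (g : Fin k → Sequence) n →
  convolution f (λ n → sumℚ (λ t → g t n)) n ≡ sumℚ (λ t → convolution f (g t) n)
convolution-sum f g zero    = *-distribˡ-sum (f 0) (λ t → g t 0)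
convolution-sum f g (suc n) = trans
  (cong₂ ℚ._+_ (*-distribˡ-sum (f 0) (λ t → g t (suc n))) (convolution-sum (f ∘ suc) g n))
  (sym (∑ℚ-distrib-+ (λ t → f 0 ℚ.* g t (suc n)) (λ t → convolution (f ∘ suc) (g t) n)))

bounded-above : ∀ {n} (f : Fin n → ℕ) → ∃[ d ] (∀ i → f i ℕ.≤ d)
bounded-above {zero}  f = 0 , λ ()
bounded-above {suc n} f = let d , f≤d = bounded-above (f ∘ suc) in
  f zero ℕ.⊔ d , λ { zero → ℕ.m≤m⊔n (f zero) d ; (suc i) → ℕ.m≤n⇒m≤o⊔n (f zero) (f≤d i) }

-- There are k N unknown coefficients of c_0, …, c_{k-1} in degrees below N and
-- r (N + d) equations, fewer than k N once N > r d.
module Relation {r k} (r<k : r ℕ.< k) (v : Fin r → Fin k → ℕ) where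

  private
    d : ℕ
    d = proj₁ (bounded-above (λ t → proj₁ (bounded-above (v t))))

    v≤d : ∀ t j → v t j ℕ.≤ d
    v≤d t j = ℕ.≤-trans (proj₂ (bounded-above (v t)) j)
      (proj₂ (bounded-above (λ t → proj₁ (bounded-above (v t)))) t)

    N : ℕ
    N = suc (r ℕ.* d)

    equations<unknowns : r ℕ.* (N ℕ.+ d) ℕ.< k ℕ.* N
    equations<unknowns = begin-strict
      r ℕ.* (N ℕ.+ d)           ≡⟨ ℕ.*-distribˡ-+ r N d ⟩
      r ℕ.* N ℕ.+ r ℕ.* d       <⟨ ℕ.+-monoʳ-< (r ℕ.* N) (ℕ.n<1+n (r ℕ.* d)) ⟩
      r ℕ.* N ℕ.+ N             ≡⟨ ℕ.+-comm (r ℕ.* N) N ⟩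
      suc r ℕ.* N               ≤⟨ ℕ.*-monoˡ-≤ N r<k ⟩
      k ℕ.* N                   ∎
      where open ℕ.≤-Reasoning

    column : Fin (k ℕ.* N) → Fin k
    column q = proj₁ (remQuot {k} N q)

    degree : Fin (k ℕ.* N) → ℕ
    degree q = toℕ (proj₂ (remQuot {k} N q))

    unknown-injective : ∀ {p q} → column p ≡ column q → degree p ≡ degree q → p ≡ q
    unknown-injective {p} {q} c≡ d≡ = trans (sym (Fin.combine-remQuot {k} N p))
      (trans (cong₂ combine c≡ (Fin.toℕ-injective d≡)) (Fin.combine-remQuot {k} N q))

    -- Equation (t, m) says that the coefficient of z^m in Σ_j z^(v t j) c_j is 0. The unknown `q`
    -- is the coefficient of degree `degree q` in c_j for j = `column q`.
    coefficient : Fin r × Fin (N ℕ.+ d) → Fin (k ℕ.* N) → ℚ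
    coefficient (t , m) q = monomial (v t (column q) ℕ.+ degree q) (toℕ m)

    solution : Σ[ z ∈ (Fin (k ℕ.* N) → ℚ) ] (∃[ q ] z q ≢ 0ℚ) ×
      (∀ ρ → sumℚ (λ q → coefficient (remQuot {r} (N ℕ.+ d) ρ) q ℚ.* z q) ≡ 0ℚ)
    solution = nontrivialKernel equations<unknowns (λ ρ → coefficient (remQuot {r} (N ℕ.+ d) ρ))

    z : Fin (k ℕ.* N) → ℚ
    z = proj₁ solution

    -- The solution cut down to the unknowns of c_j. Each multiplier can thus be summed over all
    -- unknowns, which lets the double sum in `relation` be exchanged.
    part : Fin k → Fin (k ℕ.* N) → ℚ
    part j q = if does (column q Fin.≟ j) then z q else 0ℚ

    part-own : ∀ q → part (column q) q ≡ z q
    part-own q = cong (λ b → if b then z q else 0ℚ) (dec-true (column q Fin.≟ column q) refl)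

    part-other : ∀ {j q} → column q ≢ j → part j q ≡ 0ℚ
    part-other {j} {q} c≢j = cong (λ b → if b then z q else 0ℚ) (dec-false (column q Fin.≟ j) c≢j)

  multiplier : Fin k → Sequence
  multiplier j n = sumℚ λ q → part j q ℚ.* monomial (degree q) n

  -- A nonzero unknown is itself a coefficient of a multiplier, since distinct unknowns differ in
  -- column or in degree.
  multiplier-nonzero : ∃₂ λ j n → multiplier j n ≢ 0ℚ
  multiplier-nonzero = let q , z≢0 = proj₁ (proj₂ solution) in
    column q , degree q , z≢0 ∘ trans (sym (trans (ℚSum.sum-single (λ p → part (column q) p ℚ.* monomial (degree p) (degree q)) q (others q))
      (trans (cong₂ ℚ._*_ (part-own q) (monomial-diagonal (degree q))) (ℚ.*-identityʳ (z q)))))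
    where
    others : ∀ q p → p ≢ q → part (column q) p ℚ.* monomial (degree p) (degree q) ≡ 0ℚ
    others q p p≢q with column p Fin.≟ column q
    ... | no _    = ℚ.*-zeroˡ (monomial (degree p) (degree q))
    ... | yes c≡ = trans (cong (z p ℚ.*_) (monomial-offDiagonal λ d≡ → p≢q (unknown-injective c≡ d≡))) (ℚ.*-zeroʳ (z p))

  private
    combined : ∀ t m → sumℚ (λ q → monomial (v t (column q) ℕ.+ degree q) m ℚ.* z q) ≡ 0ℚ
    combined t m with m ℕ.<? N ℕ.+ d
    ... | yes m< = trans
      (sum-cong-≗ λ q → cong (ℚ._* z q) (trans
        (cong (monomial (v t (column q) ℕ.+ degree q)) (sym (Fin.toℕ-fromℕ< m<)))
        (cong (λ e → coefficient e q) (sym (Fin.remQuot-combine {r} {N ℕ.+ d} t (fromℕ< m<))))))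
      (proj₂ (proj₂ solution) (combine t (fromℕ< m<)))
    -- The system has no equation in these degrees; no monomial reaches them, as the shifts are at
    -- most `d` and the degrees below `N`.
    ... | no m≮ = ℚSum.sum-zero (λ q → monomial (v t (column q) ℕ.+ degree q) m ℚ.* z q) λ q → trans
      (cong (ℚ._* z q) (monomial-offDiagonal λ e → m≮ (subst (ℕ._< N ℕ.+ d) e (bound q)))) (ℚ.*-zeroˡ (z q))
      where
      bound : ∀ q → v t (column q) ℕ.+ degree q ℕ.< N ℕ.+ d
      bound q = subst (v t (column q) ℕ.+ degree q ℕ.<_) (ℕ.+-comm d N)
        (ℕ.+-mono-≤-< (v≤d t (column q)) (Fin.toℕ<n (proj₂ (remQuot {k} N q))))

  relation : ∀ t m → sumℚ (λ j → shift (v t j) (multiplier j) m) ≡ 0ℚ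
  relation t m = begin
    sumℚ (λ j → shift (v t j) (multiplier j) m)
      ≡⟨ sum-cong-≗ (λ j → trans (shift-sum (v t j) (λ q n → part j q ℚ.* monomial (degree q) n) m)
           (sum-cong-≗ λ q → trans (shift-* (v t j) (part j q) (monomial (degree q)) m)
             (cong (part j q ℚ.*_) (shift-monomial (v t j) (degree q) m)))) ⟩
    sumℚ (λ j → sumℚ λ q → part j q ℚ.* monomial (v t j ℕ.+ degree q) m)
      ≡⟨ ∑-comm (λ j q → part j q ℚ.* monomial (v t j ℕ.+ degree q) m) ⟩
    sumℚ (λ q → sumℚ λ j → part j q ℚ.* monomial (v t j ℕ.+ degree q) m)
      ≡⟨ sum-cong-≗ (λ q → trans
           (ℚSum.sum-single (λ j → part j q ℚ.* monomial (v t j ℕ.+ degree q) m) (column q) λ j j≢ → trans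
             (cong (ℚ._* monomial (v t j ℕ.+ degree q) m) (part-other (j≢ ∘ sym))) (ℚ.*-zeroˡ (monomial (v t j ℕ.+ degree q) m)))
           (trans (cong (ℚ._* monomial (v t (column q) ℕ.+ degree q) m) (part-own q)) (ℚ.*-comm (z q) (monomial (v t (column q) ℕ.+ degree q) m)))) ⟩
    sumℚ (λ q → monomial (v t (column q) ℕ.+ degree q) m ℚ.* z q)
      ≡⟨ combined t m ⟩
    0ℚ ∎
    where open ≡-Reasoning

-- Power series over ℚ as generalized power series

module _ {c ℓ} (M : Monoid c ℓ) (h : ℚ → Monoid.Carrier M) where
  open Monoid M using (_≈_; _∙_; ∙-cong; identityʳ) renaming (Carrier to A; trans to ≈-trans; sym to ≈-sym)
  open FiniteSum M using (listSum)

  -- Stated for any enumeration `e`, because the induction drops the first exponent together with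
  -- the constant term of `f`.
  listSum-convolution : (∀ p q → h (p ℚ.+ q) ≈ h p ∙ h q) → ∀ {B : Set} (F : B → A) (e : ℕ → B) f g n →
    (∀ i → i ℕ.≤ n → F (e i) ≈ h (f i ℚ.* g (n ℕ.∸ i))) →
    listSum F (applyUpTo e (suc n)) ≈ h (convolution f g n)
  listSum-convolution h-+ F e f g zero    F≈ = ≈-trans (identityʳ (F (e 0))) (F≈ 0 ℕ.z≤n)
  listSum-convolution h-+ F e f g (suc n) F≈ = ≈-trans
    (∙-cong (F≈ 0 ℕ.z≤n)
      (listSum-convolution h-+ F (e ∘ suc) (f ∘ suc) g n λ i i≤n → F≈ (suc i) (ℕ.s≤s i≤n)))
    (≈-sym (h-+ (f 0 ℚ.* g (suc n)) (convolution (f ∘ suc) g n)))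

summand≤sum : ∀ {n} (f : Fin n → ℚ) → (∀ i → 0ℚ ℚ.≤ f i) → ∀ i → f i ℚ.≤ sumℚ f
summand≤sum {suc n} f 0≤f zero    = subst (ℚ._≤ sumℚ f) (ℚ.+-identityʳ (f zero))
  (ℚ.+-monoʳ-≤ (f zero) (sum-nonNeg (f ∘ suc) (0≤f ∘ suc)))
  where
  sum-nonNeg : ∀ {n} (f : Fin n → ℚ) → (∀ i → 0ℚ ℚ.≤ f i) → 0ℚ ℚ.≤ sumℚ f
  sum-nonNeg {zero}  f 0≤f = ℚ.≤-refl
  sum-nonNeg {suc n} f 0≤f = subst (ℚ._≤ sumℚ f) (ℚ.+-identityˡ 0ℚ) (ℚ.+-mono-≤ (0≤f zero) (sum-nonNeg (f ∘ suc) (0≤f ∘ suc)))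
summand≤sum {suc n} f 0≤f (suc i) = ℚ.≤-trans (summand≤sum (f ∘ suc) (0≤f ∘ suc) i)
  (subst (ℚ._≤ sumℚ f) (ℚ.+-identityˡ (sumℚ (f ∘ suc))) (ℚ.+-monoˡ-≤ (sumℚ (f ∘ suc)) (0≤f zero)))

module PowerSeries (em : ExcludedMiddle 0ℓ) where

  IsNatural : ℝ → Set
  IsNatural γ = ∃[ n ] γ ≃ fromℕ n

  -- The decision is an argument because `em` does not reduce; lemmas can then match on it.
  value : Sequence → ∀ {γ} → Dec (IsNatural γ) → ℂ
  value f (yes (n , _)) = fromℚᶜ (f n)
  value f (no _)        = 0ᶜ

  value-natural : ∀ f {γ} (d : Dec (IsNatural γ)) {n} → γ ≃ fromℕ n → value f d ≡ fromℚᶜ (f n)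
  value-natural f (yes (m , γ≃m)) {n} γ≃n =
    cong (λ n → fromℚᶜ (f n)) (fromℕ-injective {m} {n} (≃-trans (≃-sym γ≃m) γ≃n))
  value-natural f (no γ∉ℕ) {n} γ≃n = contradiction (n , γ≃n) γ∉ℕ

  value-other : ∀ f {γ} (d : Dec (IsNatural γ)) → ¬ IsNatural γ → value f d ≡ 0ᶜ
  value-other f (yes γ∈ℕ) γ∉ℕ = contradiction γ∈ℕ γ∉ℕ
  value-other f (no _)    _   = refl

  coefficient : Sequence → ℝ → ℂ
  coefficient f γ = value f (em {IsNatural γ})

  -- The interface between generalized series and sequences: the later lemmas use these two facts
  -- and never unfold the decision in `coefficient`.
  record Represents (φ : ℝ → ℂ) (f : Sequence) : Set where
    field
      at-natural : ∀ {γ n} → γ ≃ fromℕ n → φ γ ≃ᶜ fromℚᶜ (f n)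
      elsewhere  : ∀ {γ} → ¬ IsNatural γ → φ γ ≃ᶜ 0ᶜ

  open Represents

  coefficient-represents : ∀ f → Represents (coefficient f) f
  coefficient-represents f .at-natural {γ} {n} γ≃n = ≡⇒≃ᶜ (value-natural f (em {IsNatural γ}) {n} γ≃n)
  coefficient-represents f .elsewhere {γ} γ∉ℕ      = ≡⇒≃ᶜ (value-other f (em {IsNatural γ}) γ∉ℕ)

  module _ {φ : ℝ → ℂ} {f : Sequence} (R : Represents φ f) where

    represents-cong : ∀ {γ δ} → γ ≃ δ → φ γ ≃ᶜ φ δ
    represents-cong {γ} {δ} γ≃δ = case em {IsNatural γ} of λ
      { (yes (n , γ≃n)) → ≃ᶜ-trans (at-natural R {γ} {n} γ≃n)
          (≃ᶜ-sym (at-natural R {δ} {n} (≃-trans (≃-sym γ≃δ) γ≃n)))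
      ; (no γ∉ℕ) → ≃ᶜ-trans (elsewhere R {γ} γ∉ℕ)
          (≃ᶜ-sym (elsewhere R {δ} λ (n , δ≃n) → γ∉ℕ (n , ≃-trans γ≃δ δ≃n))) }

    support-natural : ∀ γ → InSupport φ γ → ∃[ n ] γ ≃ fromℕ n × f n ≢ 0ℚ
    support-natural γ γ∈ = case em {IsNatural γ} of λ
      { (yes (n , γ≃n)) → n , γ≃n , λ fn≡0 → γ∈ (≃ᶜ⇒≈ {φ γ} {0ᶜ}
          (≃ᶜ-trans (at-natural R {γ} {n} γ≃n) (≡⇒≃ᶜ (cong fromℚᶜ fn≡0))))
      ; (no γ∉ℕ) → contradiction (≃ᶜ⇒≈ {φ γ} {0ᶜ} (elsewhere R {γ} γ∉ℕ)) γ∈ }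

    -- Exponents in the support are natural numbers, so the descent takes place in ℕ.
    support-wellFounded : WellFounded {A = ∃ (InSupport φ)} (_<ᵣ_ on proj₁)
    support-wellFounded (γ , γ∈) =
      let n , γ≃n , _ = support-natural γ γ∈ in descend n (<-wellFounded n) γ γ∈ γ≃n
      where
      descend : ∀ n → Acc ℕ._<_ n → ∀ γ γ∈ → γ ≃ fromℕ n → Acc {A = ∃ (InSupport φ)} (_<ᵣ_ on proj₁) (γ , γ∈)
      descend n (acc rec) γ γ∈ γ≃n = acc λ { {δ , δ∈} δ<γ →
        let m , δ≃m , _ = support-natural δ δ∈
        in  descend m (rec (ℕ.≰⇒> λ n≤m → <⇒⋦ {δ} {γ} δ<γ
              (≲-trans (≃⇒≲ γ≃n) (≲-trans (fromℕ-mono {n} {m} n≤m) (≃⇒≲ (≃-sym δ≃m)))))) δ δ∈ δ≃m }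

  series : Sequence → K
  series f = record
    { coeff       = coefficient f
    ; coeff-cong  = λ {γ} {δ} γ≈δ → ≃ᶜ⇒≈ {coefficient f γ} {coefficient f δ} (represents-cong (coefficient-represents f) {γ} {δ} (⟪_⟫ {γ} {δ} γ≈δ))
    ; wellOrdered = support-wellFounded (coefficient-represents f)
    }

  series-represents : ∀ f → Represents (coeff (series f)) f
  series-represents = coefficient-represents

  subtract-natural : ∀ γ n i → γ ≃ fromℕ n → i ℕ.≤ n → γ -ᵣ fromℕ i ≃ fromℕ (n ℕ.∸ i)
  subtract-natural γ n i γ≃n i≤n = ≃-trans
    (+-cong {γ} {fromℕ n} { -ᵣ fromℕ i} { -ᵣ fromℕ i} γ≃n (≃-refl { -ᵣ fromℕ i}))
    (pointwise λ _ → trans (cong (ℚ._- fromℕℚ i) (trans (cong fromℕℚ (sym (ℕ.m∸n+n≡m i≤n))) (fromℕℚ-+ (n ℕ.∸ i) i)))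
      (cancel (fromℕℚ (n ℕ.∸ i)) (fromℕℚ i)))
    where
    cancel : ∀ p q → p ℚ.+ q ℚ.- q ≡ p
    cancel = solve 2 (λ p q → p :+ q :- q := p) refl

  add-natural : ∀ γ α i j → α ≃ fromℕ i → γ -ᵣ α ≃ fromℕ j → γ ≃ fromℕ (i ℕ.+ j)
  add-natural γ α i j α≃i γ-α≃j = ≃-trans {j = α +ᵣ (γ -ᵣ α)}
    (pointwise λ n → solve 2 (λ γ α → γ := α :+ (γ :- α)) refl (seq γ n) (seq α n))
    (≃-trans (+-cong {α} {fromℕ i} {γ -ᵣ α} {fromℕ j} α≃i γ-α≃j) (≃-sym (fromℕ-+ i j)))

  module _ {F G H : K} {f g h : Sequence} (RF : Represents (coeff F) f) (RG : Represents (coeff G) g)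
    (RH : Represents (coeff H) h) (h≗ : ∀ n → h n ≡ convolution f g n) where

    private
      exponents-add : ∀ γ α → InSupport (coeff F) α → InSupport (coeff G) (γ -ᵣ α) →
        ∃₂ λ i j → α ≃ fromℕ i × γ ≃ fromℕ (i ℕ.+ j)
      exponents-add γ α α∈ γ-α∈ =
        let i , α≃i , _ = support-natural RF α α∈
            j , β≃j , _ = support-natural RG (γ -ᵣ α) γ-α∈
        in  i , j , α≃i , add-natural γ α i j α≃i β≃j

      covers : ∀ γ n → γ ≃ fromℕ n → ∀ α → InSupport (coeff F) α → InSupport (coeff G) (γ -ᵣ α) →
        α ∈ᵣ applyUpTo fromℕ (suc n)
      covers γ n γ≃n α α∈ γ-α∈ =
        let i , j , α≃i , γ≃i+j = exponents-add γ α α∈ γ-α∈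
            n≡i+j = fromℕ-injective {n} {i ℕ.+ j} (≃-trans (≃-sym γ≃n) γ≃i+j)
        in  Any.applyUpTo⁺ fromℕ {i = i} (_≃_.≈ {α} {fromℕ i} α≃i)
              (ℕ.s≤s (subst (i ℕ.≤_) (sym n≡i+j) (ℕ.m≤m+n i j)))

      summand : ∀ γ n → γ ≃ fromℕ n → ∀ i → i ℕ.≤ n →
        coeff F (fromℕ i) *ᶜ coeff G (γ -ᵣ fromℕ i) ≃ᶜ fromℚᶜ (f i ℚ.* g (n ℕ.∸ i))
      summand γ n γ≃n i i≤n = ≃ᶜ-trans
        (*ᶜ-cong (coeff F (fromℕ i)) (fromℚᶜ (f i)) (coeff G (γ -ᵣ fromℕ i)) (fromℚᶜ (g (n ℕ.∸ i)))
          (at-natural RF {fromℕ i} {i} (≃-refl {fromℕ i}))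
          (at-natural RG {γ -ᵣ fromℕ i} {n ℕ.∸ i} (subtract-natural γ n i γ≃n i≤n)))
        (≃ᶜ-sym (fromℚᶜ-* (f i) (g (n ℕ.∸ i))))

      total : ∀ γ n → γ ≃ fromℕ n → coeff H γ ≃ᶜ
        ℂSum.listSum (λ α → coeff F α *ᶜ coeff G (γ -ᵣ α)) (applyUpTo fromℕ (suc n))
      total γ n γ≃n = ≃ᶜ-trans (at-natural RH {γ} {n} γ≃n) (≃ᶜ-trans (≡⇒≃ᶜ (cong fromℚᶜ (h≗ n)))
        (≃ᶜ-sym (listSum-convolution +ᶜ-monoid fromℚᶜ fromℚᶜ-+ (λ α → coeff F α *ᶜ coeff G (γ -ᵣ α)) fromℕ f g n (summand γ n γ≃n))))

      productAt : ∀ γ → Dec (IsNatural γ) → Σ[ αs ∈ List ℝ ] Uniqueᵣ αs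
        × (∀ α → InSupport (coeff F) α → InSupport (coeff G) (γ -ᵣ α) → α ∈ᵣ αs)
        × coeff H γ ≃ᶜ ℂSum.listSum (λ α → coeff F α *ᶜ coeff G (γ -ᵣ α)) αs
      -- Contributing exponents i and j satisfy i + j = n, so 0, ..., n cover them. At a non-natural
      -- `γ` nothing contributes and the empty list will do.
      productAt γ (yes (n , γ≃n)) = applyUpTo fromℕ (suc n) ,
        UniqueProperties.applyUpTo⁺₁ ℝ-setoid fromℕ (suc n)
          (λ {i} {j} i<j _ i≈j → ℕ.<⇒≢ i<j (fromℕ-injective {i} {j} (⟪_⟫ {fromℕ i} {fromℕ j} i≈j))) ,
        covers γ n γ≃n , total γ n γ≃n
      productAt γ (no γ∉ℕ) = [] , AllPairs.[] ,
        (λ α α∈ γ-α∈ → let i , j , _ , γ≃i+j = exponents-add γ α α∈ γ-α∈ in contradiction (i ℕ.+ j , γ≃i+j) γ∉ℕ) ,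
        elsewhere RH {γ} γ∉ℕ

    isProduct : IsProduct F G H
    isProduct γ = let αs , unique , covers , H≃ = productAt γ (em {IsNatural γ}) in
      αs , unique , covers ,
      ≃ᶜ⇒≈ {coeff H γ} {List.foldr _+ᶜ_ 0ᶜ (List.map (λ α → coeff F α *ᶜ coeff G (γ -ᵣ α)) αs)} H≃

  represents-sum≡0 : ∀ {k} (φ : Fin k → ℝ → ℂ) (h : Fin k → Sequence) → (∀ j → Represents (φ j) (h j)) →
    (∀ n → sumℚ (λ j → h j n) ≡ 0ℚ) → ∀ γ → sumᶜ (λ j → φ j γ) ≃ᶜ 0ᶜ
  represents-sum≡0 φ h R h≡0 γ = case em {IsNatural γ} of λ
    { (yes (n , γ≃n)) → ≃ᶜ-trans
        (ℂSum.sum-cong-≋ {x = λ j → φ j γ} {y = λ j → fromℚᶜ (h j n)} (λ j → at-natural (R j) {γ} {n} γ≃n))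
        (≃ᶜ-trans (≃ᶜ-sym (fromℚᶜ-sum (λ j → h j n))) (≡⇒≃ᶜ (cong fromℚᶜ (h≡0 n))))
    ; (no γ∉ℕ) → ℂSum.sum-zero (λ j → φ j γ) (λ j → elsewhere (R j) {γ} γ∉ℕ) }

-- Kapranov rank

module KapranovLift (em : ExcludedMiddle 0ℓ) {X Y : Set} (W : X → Y → ℕ) {r} (u : Fin r → X → ℕ) (v : Fin r → Y → ℕ)
  (bound : ∀ t x y → W x y ℕ.≤ u t x ℕ.+ v t y) (attained : ∀ x y → ∃[ t ] u t x ℕ.+ v t y ℕ.≤ W x y) where
  open PowerSeries em

  liftSequence : X → Y → Sequence
  liftSequence x y n = sumℚ λ t → monomial (u t x ℕ.+ v t y) n

  -- The coefficients of the lift are nonnegative, so its terms do not cancel.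
  liftSequence-W≢0 : ∀ x y → liftSequence x y (W x y) ≢ 0ℚ
  liftSequence-W≢0 x y eq = let t , ≤W = attained x y in ℚ<⇒≱ (ℚ.positive⁻¹ 1ℚ)
    (subst₂ ℚ._≤_
      (trans (cong (λ n → monomial n (W x y)) (ℕ.≤-antisym ≤W (bound t x y))) (monomial-diagonal (W x y))) eq
      (summand≤sum (λ t → monomial (u t x ℕ.+ v t y) (W x y)) (λ t → monomial-nonNeg (u t x ℕ.+ v t y) (W x y)) t))

  liftSequence-support : ∀ x y n → liftSequence x y n ≢ 0ℚ → W x y ℕ.≤ n
  liftSequence-support x y n ≢0 = ℕ.≮⇒≥ λ n<W → ≢0 (ℚSum.sum-zero (λ t → monomial (u t x ℕ.+ v t y) n) λ t →
    monomial-offDiagonal (ℕ.>⇒≢ (ℕ.<-≤-trans n<W (bound t x y))))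

  module _ (A : X → Y → K) (represents : ∀ x y → Represents (coeff (A x y)) (liftSequence x y)) where

    W∈support : ∀ x y → InSupport (coeff (A x y)) (fromℕ (W x y))
    W∈support x y h = liftSequence-W≢0 x y (fromℚᶜ≃0⇒≡0 (≃ᶜ-trans
      (≃ᶜ-sym (Represents.at-natural (represents x y) {fromℕ (W x y)} {W x y} (≃-refl {fromℕ (W x y)})))
      (≈⇒≃ᶜ {coeff (A x y) (fromℕ (W x y))} {0ᶜ} h)))

    isLift : IsLift (λ x y → fromℕ (W x y)) A
    isLift x y = (λ isZero → W∈support x y (isZero (fromℕ (W x y)))) , W∈support x y , λ δ δ∈ →
      let n , δ≃n , ≢0 = support-natural (represents x y) δ δ∈
      in  _≲_.≤ {fromℕ (W x y)} {δ} (≲-trans (fromℕ-mono {W x y} {n} (liftSequence-support x y n ≢0)) (≃⇒≲ (≃-sym δ≃n)))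

    -- The relation Σ_j c_j z^(v_t(y_j)) = 0, valid for each t, does not involve x. Multiplied by
    -- z^(u_t(x)) and summed over t it becomes Σ_j c_j A(x, y_j) = 0, with the same c_j in every
    -- row.
    independent≤factorization : ∀ {k} (col : Fin k → Y) → IsIndependent (λ x j → A x (col j)) → k ℕ.≤ r
    independent≤factorization {k} col independent = ℕ.≮⇒≥ λ r<k → contradict (Relation.multiplier r<k v′)
        (Relation.multiplier-nonzero r<k v′) (Relation.relation r<k v′)
      where
      v′ : Fin r → Fin k → ℕ
      v′ t j = v t (col j)

      module _ (c : Fin k → Sequence) (relation : ∀ t m → sumℚ (λ j → shift (v′ t j) (c j) m) ≡ 0ℚ) where
        productSequence : X → Fin k → Sequence
        productSequence x j n = sumℚ λ t → shift (u t x ℕ.+ v t (col j)) (c j) n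

        productSequence-convolution : ∀ x j n → productSequence x j n ≡ convolution (c j) (liftSequence x (col j)) n
        productSequence-convolution x j n = sym (trans
          (convolution-sum (c j) (λ t → monomial (u t x ℕ.+ v t (col j))) n)
          (sum-cong-≗ λ t → convolution-monomial (c j) (u t x ℕ.+ v t (col j)) n))

        sum-productSequence : ∀ x n → sumℚ (λ j → productSequence x j n) ≡ 0ℚ
        sum-productSequence x n = begin
          sumℚ (λ j → sumℚ λ t → shift (u t x ℕ.+ v t (col j)) (c j) n)
            ≡⟨ ∑-comm (λ j t → shift (u t x ℕ.+ v t (col j)) (c j) n) ⟩
          sumℚ (λ t → sumℚ λ j → shift (u t x ℕ.+ v t (col j)) (c j) n)
            ≡⟨ ℚSum.sum-zero (λ t → sumℚ λ j → shift (u t x ℕ.+ v t (col j)) (c j) n) (λ t → begin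
                 sumℚ (λ j → shift (u t x ℕ.+ v t (col j)) (c j) n)
                   ≡⟨ sum-cong-≗ (λ j → shift-∘ (u t x) (v t (col j)) (c j) n) ⟩
                 sumℚ (λ j → shift (u t x) (shift (v t (col j)) (c j)) n)
                   ≡⟨ shift-sum (u t x) (λ j → shift (v t (col j)) (c j)) n ⟨
                 shift (u t x) (λ n → sumℚ λ j → shift (v t (col j)) (c j) n) n
                   ≡⟨ shift-cong (u t x) (relation t) n ⟩
                 shift (u t x) (λ _ → 0ℚ) n
                   ≡⟨ shift-zero (u t x) n ⟩
                 0ℚ ∎) ⟩
          0ℚ ∎
          where open ≡-Reasoning

        multipliers-vanish : ∀ j → IsZero (series (c j))
        multipliers-vanish = independent (λ j → series (c j)) (λ x j → series (productSequence x j))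
          (λ x j → isProduct {series (c j)} {A x (col j)} {series (productSequence x j)}
            (series-represents (c j)) (represents x (col j)) (series-represents (productSequence x j))
            (productSequence-convolution x j))
          (λ x γ → ≃ᶜ⇒≈ {sumᶜ (λ j → coeff (series (productSequence x j)) γ)} {0ᶜ}
            (represents-sum≡0 (λ j → coeff (series (productSequence x j))) (productSequence x)
              (λ j → series-represents (productSequence x j)) (sum-productSequence x) γ))

      contradict : ∀ c → (∃₂ λ j n → c j n ≢ 0ℚ) → (∀ t m → sumℚ (λ j → shift (v′ t j) (c j) m) ≡ 0ℚ) → ⊥
      contradict c (j , n , ≢0) relation = ≢0 (fromℚᶜ≃0⇒≡0 (≃ᶜ-trans
        (≃ᶜ-sym (Represents.at-natural (series-represents (c j)) {fromℕ n} {n} (≃-refl {fromℕ n})))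
        (≈⇒≃ᶜ {coeff (series (c j)) (fromℕ n)} {0ᶜ} (multipliers-vanish c relation j (fromℕ n)))))

module _ (em : ExcludedMiddle 0ℓ) {X Y : Set} (W : X → Y → ℕ) {r} (F : Factorization W r) (S : FoolingSet W r) where
  open Factorization F using (u; v; bound; attained)
  open KapranovLift em W u v bound attained
  open PowerSeries em using (series; series-represents)

  -- The columns of the fooling set are independent in every lift: this gives the lower bound, and
  -- also shows that the constructed lift attains rank r.
  kapranovRank : IsKapranovRank (λ x y → fromℕ (W x y)) r
  kapranovRank =
    (lift , isLift lift represents , (FoolingSet.col S , independent lift (isLift lift represents)) ,
      λ { k (col , independent) → independent≤factorization lift represents col independent }) ,
    λ { k (A , isLift , _ , greatest) → greatest r (FoolingSet.col S , independent A isLift) }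
    where
    lift : X → Y → K
    lift x y = series (liftSequence x y)
    represents = λ x y → series-represents (liftSequence x y)
    independent : ∀ A → IsLift (λ x y → fromℕ (W x y)) A → IsIndependent (λ x j → A x (FoolingSet.col S j))
    independent = Products.separated-independent em W (FoolingSet.row S) (FoolingSet.col S)
      (FoolingSet.diagonal S) (FoolingSet.offDiagonal S)

-- The certificates for the decoding matrix

decodingFactorization : ∀ {m} (C : LinearCode m) (L : Subset m) {n} → Transversal C L n → Factorization (decodingMatrix C L) n
decodingFactorization C L T = record
  { u        = leftDistance C L T
  ; v        = rightDistance C L T
  ; bound    = decoding≤distances C L T
  ; attained = distances≤decoding C L T
  }

decodingFoolingSet : ∀ {m} (C : LinearCode m) (L : Subset m) {n} → Transversal C L n → FoolingSet (decodingMatrix C L) n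
decodingFoolingSet C L T = record
  { row         = λ t → restrict L (Transversal.rep T t)
  ; col         = λ t → restrict (∁ L) (Transversal.rep T t)
  ; diagonal    = decoding-diagonal C L T
  ; offDiagonal = decoding-offDiagonal C L T
  }

theorem1 : ∀ (m : ℕ) (C : LinearCode m) (L : Subset m) →
    let W = λ x y → fromℕ (decodingMatrix C L x y)
        s = dim C ∸ dim (vanishingOn (∁ L) C) ∸ dim (vanishingOn L C)
    in  IsMinPlusRank W (2 ^ s)
      × IsTropicalRank W (2 ^ s)
      × (ExcludedMiddle 0ℓ → IsKapranovRank W (2 ^ s))
theorem1 m C L =
  minPlusRank (decodingMatrix C L) F S , tropicalRank (decodingMatrix C L) F S ,
  λ em → kapranovRank em (decodingMatrix C L) F S
  where
  T = transversal C L (proj₂ (dimension C)) (proj₂ (dimension (vanishingOn (∁ L) C))) (proj₂ (dimension (vanishingOn L C)))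
  F = decodingFactorization C L T
  S = decodingFoolingSet C L T
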